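{- Let $t$ be a closed term. (1) For any run of the Silly MAM $\mathbb{Q}\to^*\mathbb{Q}'$ from an initial state $\mathbb{Q}$ of $t$, there is a reduction sequence $t\to_{w\neg gcv}^* s$ with $s \Rrightarrow \overline{\mathbb{Q}'}$. (2) For every reduction sequence $t\to_{w\neg gcv}^* a$ to an answer $a$, there is a run $\mathbb{Q}\to^*\mathbb{Q}'$ of the Silly MAM from an initial state $\mathbb{Q}$ of $t$ such that $a\Rrightarrow\overline{\mathbb{Q}'}$.
   Context: Terms: $t ::= x \mid \lambda x.t \mid t\,u \mid t[x\backslash u]$ ($t[x\backslash u]$ an explicit substitution binding $x$ in $t$). Values $v ::= \lambda x.t$. Substitution contexts $S ::= \langle\cdot\rangle\mid S[x\backslash u]$. Weak contexts $W ::= \langle\cdot\rangle \mid W\,t \mid t\,W \mid t[x\backslash W] \mid W[x\backslash u]$; $W\langle\langle t\rangle\rangle$ is plugging without capture of free variables of $t$. $\to_{w\neg gcv}$ is the closure under weak contexts of $S\langle\lambda x.t\rangle u\mapsto_m S\langle t[x\backslash u]\rangle$ and $W\langle\langle x\rangle\rangle[x\backslash u]\mapsto_e W\langle\langle u\rangle\rangle[x\backslash u]$. Answers: $a ::= v\mid a[x\backslash a']$. Silly MAM: states $(C, t, \pi, E)$ with partial answer $C ::= \epsilon\mid C::(v,x)$, code $t$ (a term not taken up to $\alpha$), stack $\pi ::= \epsilon\mid t::\pi$, environment $E ::= \epsilon\mid [x\backslash t]::E$. Transitions: $(C,tu,\pi,E)\to(C,t,u::\pi,E)$; $(C,\lambda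 x.t,u::\pi,E)\to(C,t,\pi,[x\backslash u]::E)$; $(C,x,\pi,E_1::[x\backslash t]::E_2)\to(C,t^\alpha,\pi,E_1::[x\backslash t]::E_2)$ where $t^\alpha$ is $\alpha$-equivalent to $t$ with pairwise distinct bound names fresh w.r.t. the rest of the state; $(C,v,\epsilon,[x\backslash t]::E)\to(C::(v,x),t,\epsilon,E)$. An initial state of a closed term $t$ is $(\epsilon,t',\epsilon,\epsilon)$ with $t'$ an $\alpha$-representative of $t$ whose bound names are pairwise distinct. Read-back (contexts): $\overline{\epsilon}=\langle\cdot\rangle$; $\overline{t::\pi}=\overline{\pi}\langle\langle\cdot\rangle t\rangle$; $\overline{[x\backslash t]::E}=\overline{E}\langle\langle\cdot\rangle[x\backslash t]\rangle$; $\overline{C::(v,x)}=\overline{C}\langle v\rangle[x\backslash\langle\cdot\rangle]$; states: $\overline{(C,t,\pi,E)}=\overline{E}\langle\overline{C}\langle\overline{\pi}\langle t\rangle\rangle\rangle$. Structural reductions: $\leadsto_{@l}$ is the reflexive-transitive closure, under weak contexts, of $(t[x\backslash u])s\leadsto(ts)[x\backslash u]$ if $x\notin\mathrm{fv}(s)$; $\leadsto_{ans}$ is the reflexive closure, under substitution contexts, of $a[x\backslash t[y\backslash u]]\leadsto a[x\backslash t][y\backslash u]$ if $y\notin\mathrm{fv}(a)$, $a$ an answer. $t\Rrightarrow u$ means $t\leadsto_{@l} s\leadsto_{ans} u$ for some $s$.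
   Formalization: The ans structural reduction is taken reflexive-transitive (one step does not suffice, e.g. for (λx.I)((λy.(λz.I)I)I)), and part (2) assumes t has no explicit substitutions, since the machine is stuck on a code t[x\u], e.g. (I I)[x\I]. -}

module Defs where

open import Data.List.Base using (List; []; _∷_; _++_; filter)
open import Data.List.Membership.Propositional using (_∉_)
open import Data.List.Relation.Binary.Disjoint.Propositional using (Disjoint)
open import Data.List.Relation.Unary.Unique.Propositional using (Unique)
open import Data.Nat.Base using (ℕ)
open import Data.Nat.Properties using (_≟_)
open import Data.Product.Base using (_×_; _,_)
open import Level using (0ℓ)
open import Relation.Binary.Construct.Closure.ReflexiveTransitive using (Star)
open import Relation.Binary.Construct.Composition using (_;_)
open import Relation.Binary.Core using (Rel)
open import Relation.Binary.PropositionalEquality using (_≡_)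
open import Relation.Nullary.Decidable using (yes; no; ¬?)

Name : Set
Name = ℕ

infixl 7 _·_
infixl 8 _[_∖_]

-- Named syntax, not quotiented: machine codes are such raw terms. The calculus
-- works on the same terms modulo the relation _=α_ below.
data Term : Set where
  var    : Name → Term
  ƛ      : Name → Term → Term
  _·_    : Term → Term → Term
  _[_∖_] : Term → Name → Term → Term   -- t [ x ∖ u ] binds x in t, not in u

private variable
  x y z           : Name
  t t′ u u′ s a b : Term

fv : Term → List Name
fv (var x)       = x ∷ []
fv (ƛ x t)       = filter (λ y → ¬? (y ≟ x)) (fv t)
fv (t · u)       = fv t ++ fv u
fv (t [ x ∖ u ]) = filter (λ y → ¬? (y ≟ x)) (fv t) ++ fv u

Closed : Term → Set
Closed t = fv t ≡ []

-- With multiplicity, so that `Unique (bv t)` says that the bound names of t are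
-- pairwise distinct.
bv : Term → List Name
bv (var x)       = []
bv (ƛ x t)       = x ∷ bv t
bv (t · u)       = bv t ++ bv u
bv (t [ x ∖ u ]) = x ∷ bv t ++ bv u

names : Term → List Name
names (var x)       = x ∷ []
names (ƛ x t)       = x ∷ names t
names (t · u)       = names t ++ names u
names (t [ x ∖ u ]) = x ∷ names t ++ names u

-- Ordinary λ-terms. The machine has no transition for a code of the form t [ x ∖ u ],
-- so only these can be evaluated to the end.
data ESFree : Term → Set where
  var : ESFree (var x)
  ƛ   : ESFree t → ESFree (ƛ x t)
  _·_ : ESFree t → ESFree u → ESFree (t · u)

swapName : Name → Name → Name → Name
swapName x y z with z ≟ x | z ≟ y
... | yes _ | _     = y
... | no  _ | yes _ = x
... | no  _ | no  _ = z

swap : Name → Name → Term → Term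
swap x y (var z)       = var (swapName x y z)
swap x y (ƛ z t)       = ƛ (swapName x y z) (swap x y t)
swap x y (t · u)       = swap x y t · swap x y u
swap x y (t [ z ∖ u ]) = swap x y t [ swapName x y z ∖ swap x y u ]

infix 4 _=α_

-- α-equivalence in the nominal style: two binders are compared after swapping
-- both bound names with one fresh name z.
data _=α_ : Rel Term 0ℓ where
  var : var x =α var x
  ƛ   : z ∉ names (ƛ x t) → z ∉ names (ƛ y u) →
        swap x z t =α swap y z u →
        ƛ x t =α ƛ y u
  _·_ : t =α t′ → u =α u′ → t · u =α t′ · u′
  es  : z ∉ x ∷ names t → z ∉ y ∷ names t′ →
        swap x z t =α swap y z t′ → u =α u′ →
        t [ x ∖ u ] =α t′ [ y ∖ u′ ]

data Answer : Term → Set where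
  val : Answer (ƛ x t)
  es  : Answer a → Answer b → Answer (a [ x ∖ b ])

data WCtx : Set where
  □       : WCtx
  _·ˡ_    : WCtx → Term → WCtx
  _·ʳ_    : Term → WCtx → WCtx
  _[_∖_]ʳ : Term → Name → WCtx → WCtx
  _[_∖_]ˡ : WCtx → Name → Term → WCtx

infix 9 _⟨_⟩

-- Plain plugging: it may capture free variables of the plugged term.
_⟨_⟩ : WCtx → Term → Term
□              ⟨ t ⟩ = t
(W ·ˡ u)       ⟨ t ⟩ = W ⟨ t ⟩ · u
(u ·ʳ W)       ⟨ t ⟩ = u · W ⟨ t ⟩
(u [ x ∖ W ]ʳ) ⟨ t ⟩ = u [ x ∖ W ⟨ t ⟩ ]
(W [ x ∖ u ]ˡ) ⟨ t ⟩ = W ⟨ t ⟩ [ x ∖ u ]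

_⟪_⟫ : WCtx → WCtx → WCtx
□              ⟪ V ⟫ = V
(W ·ˡ u)       ⟪ V ⟫ = (W ⟪ V ⟫) ·ˡ u
(u ·ʳ W)       ⟪ V ⟫ = u ·ʳ (W ⟪ V ⟫)
(u [ x ∖ W ]ʳ) ⟪ V ⟫ = u [ x ∖ W ⟪ V ⟫ ]ʳ
(W [ x ∖ u ]ˡ) ⟪ V ⟫ = (W ⟪ V ⟫) [ x ∖ u ]ˡ

-- The names a context binds at its hole.
captured : WCtx → List Name
captured □              = []
captured (W ·ˡ u)       = captured W
captured (u ·ʳ W)       = captured W
captured (u [ x ∖ W ]ʳ) = captured W
captured (W [ x ∖ u ]ˡ) = x ∷ captured W

-- W⟨⟨t⟩⟩ is W ⟨ t ⟩ together with NoCapture W t.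
NoCapture : WCtx → Term → Set
NoCapture W t = Disjoint (captured W) (fv t)

data SCtx : Set where
  □      : SCtx
  _[_∖_] : SCtx → Name → Term → SCtx

⌞_⌟ : SCtx → WCtx
⌞ □ ⌟           = □
⌞ S [ x ∖ u ] ⌟ = ⌞ S ⌟ [ x ∖ u ]ˡ

data WeakClosure (R : Rel Term 0ℓ) : Rel Term 0ℓ where
  weak : ∀ W → R t u → WeakClosure R (W ⟨ t ⟩) (W ⟨ u ⟩)

data SubstClosure (R : Rel Term 0ℓ) : Rel Term 0ℓ where
  subst : ∀ S → R t u → SubstClosure R (⌞ S ⌟ ⟨ t ⟩) (⌞ S ⌟ ⟨ u ⟩)

-- The relation induced by R on α-equivalence classes.
_/α : Rel Term 0ℓ → Rel Term 0ℓ
R /α = _=α_ ; R ; _=α_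

-- Its reflexive-transitive closure; the initial _=α_ makes it reflexive on
-- α-equivalence classes rather than on raw terms.
_*/α : Rel Term 0ℓ → Rel Term 0ℓ
R */α = _=α_ ; Star (R /α)

infix 4 _↦_ _↦＠l_ _↦ans_ _→w¬gcv*_ _⇝＠l_ _⇝ans_ _⇛_ _⟶_ _⟶*_

-- The side conditions are the variable conventions left implicit when terms are
-- taken modulo α: S must not capture u in mult, and in exp the copy of u is put
-- in the scope of x and of the binders of W.
data _↦_ : Rel Term 0ℓ where
  mult : ∀ S → NoCapture ⌞ S ⌟ u →
         ⌞ S ⌟ ⟨ ƛ x t ⟩ · u ↦ ⌞ S ⌟ ⟨ t [ x ∖ u ] ⟩
  exp  : ∀ W → NoCapture W (var x) → NoCapture W u → x ∉ fv u →
         W ⟨ var x ⟩ [ x ∖ u ] ↦ W ⟨ u ⟩ [ x ∖ u ]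

_→w¬gcv*_ : Rel Term 0ℓ
_→w¬gcv*_ = WeakClosure _↦_ */α

data _↦＠l_ : Rel Term 0ℓ where
  ＠l : x ∉ fv s → t [ x ∖ u ] · s ↦＠l (t · s) [ x ∖ u ]

_⇝＠l_ : Rel Term 0ℓ
_⇝＠l_ = WeakClosure _↦＠l_ */α

data _↦ans_ : Rel Term 0ℓ where
  ans : Answer a → y ∉ fv a →
        a [ x ∖ t [ y ∖ u ] ] ↦ans a [ x ∖ t ] [ y ∖ u ]

-- Transitivity is needed: a run that adds two entries to the environment while
-- evaluating the content of a substitution is read back with both of them
-- outside that substitution, and each takes one step to extrude.
_⇝ans_ : Rel Term 0ℓ
_⇝ans_ = SubstClosure _↦ans_ */α

_⇛_ : Rel Term 0ℓ
_⇛_ = _⇝＠l_ ; _⇝ans_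

record Value : Set where
  constructor ƛᵛ
  field
    binder : Name
    body   : Term

⌜_⌝ : Value → Term
⌜ ƛᵛ x t ⌝ = ƛ x t

data PartialAnswer : Set where
  ε       : PartialAnswer
  _∷⟨_,_⟩ : PartialAnswer → Value → Name → PartialAnswer

Stack : Set
Stack = List Term

-- The pair (x , t) is the entry [x∖t].
Env : Set
Env = List (Name × Term)

record State : Set where
  constructor ⟨_,_,_,_⟩ˢ
  field
    answer : PartialAnswer
    code   : Term
    stack  : Stack
    env    : Env

namesᶜ : PartialAnswer → List Name
namesᶜ ε               = []
namesᶜ (C ∷⟨ v , x ⟩) = namesᶜ C ++ names ⌜ v ⌝ ++ x ∷ []

namesˢ : Stack → List Name
namesˢ []      = []
namesˢ (t ∷ π) = names t ++ namesˢ π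

namesᵉ : Env → List Name
namesᵉ []            = []
namesᵉ ((x , t) ∷ E) = x ∷ names t ++ namesᵉ E

private variable
  C : PartialAnswer
  v : Value
  π : Stack
  E : Env

data _⟶_ : Rel State 0ℓ where
  push : ⟨ C , t · u , π , E ⟩ˢ ⟶ ⟨ C , t , u ∷ π , E ⟩ˢ
  beta : ⟨ C , ƛ x t , u ∷ π , E ⟩ˢ ⟶ ⟨ C , t , π , (x , u) ∷ E ⟩ˢ
  look : ∀ E₁ E₂ → let E = E₁ ++ (x , t) ∷ E₂ in
         t′ =α t → Unique (bv t′) →
         Disjoint (bv t′) (namesᶜ C ++ namesˢ π ++ namesᵉ E) →
         ⟨ C , var x , π , E ⟩ˢ ⟶ ⟨ C , t′ , π , E ⟩ˢ
  pop  : ⟨ C , ⌜ v ⌝ , [] , (x , t) ∷ E ⟩ˢ ⟶ ⟨ C ∷⟨ v , x ⟩ , t , [] , E ⟩ˢ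

_⟶*_ : Rel State 0ℓ
_⟶*_ = Star _⟶_

data InitialFor (t : Term) : State → Set where
  initial : t′ =α t → Unique (bv t′) → InitialFor t ⟨ ε , t′ , [] , [] ⟩ˢ

readᶜ : PartialAnswer → WCtx
readᶜ ε               = □
readᶜ (C ∷⟨ v , x ⟩) = (readᶜ C ⟨ ⌜ v ⌝ ⟩) [ x ∖ □ ]ʳ

readˢ : Stack → WCtx
readˢ []      = □
readˢ (t ∷ π) = readˢ π ⟪ □ ·ˡ t ⟫

readᵉ : Env → WCtx
readᵉ []            = □
readᵉ ((x , t) ∷ E) = readᵉ E ⟪ □ [ x ∖ t ]ˡ ⟫

readback : State → Term
readback ⟨ C , t , π , E ⟩ˢ = readᵉ E ⟨ readᶜ C ⟨ readˢ π ⟨ t ⟩ ⟩ ⟩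

{-# OPTIONS --safe #-}
module Submission where

-- Terms are compared through de Bruijn terms, where α-equivalence is equality and a step
-- is taken relative to the list of the surrounding substitutions.
--
-- (1) A β transition is a multiplicative step, after which the new substitution is
-- extruded from the stack (＠l) and then from the partial answer (ans); a lookup is an
-- exponential step; the other transitions do not change the read-back. Steps can be
-- pulled back along both structural reductions, and ＠l commutes before ans, so these
-- simulations compose along a run.
--
-- (2) The calculus never erases a redex. So if t makes a counted parallel step to t′ and
-- any step t → u, then u makes a parallel step to some t″ with t′ →⁺ t″, or with t″ = t′
-- and a smaller count. By induction, strong normalisation and the unique normal form go
-- back from t′ to t. Hence a term that reduces to an answer a is strongly normalising with
-- normal form a; the machine therefore stops, and the reduct it has simulated is a.

open import Data.Empty using (⊥; ⊥-elim)
open import Data.List.Base using (List; []; _∷_; _++_; map)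
open import Data.List.Membership.Propositional using (_∈_; _∉_)
open import Data.List.Membership.Propositional.Properties using (∈-filter⁺; ∈-filter⁻; ∈-++⁺ˡ; ∈-++⁺ʳ; ∈-++⁻)
open import Data.List.Properties using (++-assoc; ++-identityʳ)
open import Data.List.Relation.Binary.Disjoint.Propositional using (Disjoint)
open import Data.List.Relation.Binary.Permutation.Propositional using (_↭_; ↭-refl; ↭-trans; ↭-sym; prep; ↭-reflexive; ↭⇒↭ₛ)
open import Data.List.Relation.Binary.Permutation.Propositional.Properties using (++⁺ˡ; ++⁺ʳ; shift; shifts; ++-comm)
open import Data.List.Relation.Binary.Permutation.Setoid.Properties using (Unique-resp-↭)
open import Data.List.Relation.Unary.All as All using (All; []; _∷_)
import Data.List.Relation.Unary.All.Properties as All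
open import Data.List.Relation.Unary.AllPairs using ([]; _∷_)
open import Data.List.Relation.Unary.Any using (here; there)
open import Data.List.Relation.Unary.Unique.Propositional using (Unique)
import Data.List.Relation.Unary.Unique.Propositional.Properties as Unique
open import Data.Nat.Base using (ℕ; zero; suc; _+_; _≤_; _<_; s≤s)
open import Data.Nat.Induction using (<-wellFounded)
open import Data.Nat.ListAction using (sum)
open import Data.Nat.Properties using (_≟_; suc-injective; ≤-refl; ≤-trans; <-trans; <-≤-trans; <⇒≤; <⇒≢; <⇒≱; 1+n≰n; n<1+n; n≤1+n; m≤m+n; m≤n+m; +-suc; +-identityʳ; +-mono-≤; +-monoˡ-<; +-monoʳ-<; +-mono-≤-<; +-commutativeSemigroup)
open import Data.Product.Base using (_×_; _,_; ∃-syntax; proj₁; proj₂)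
open import Data.Sum.Base as Sum using (_⊎_; inj₁; inj₂)
open import Function.Base using (_∘_; id)
open import Induction.WellFounded using (Acc; acc)
open import Level using (0ℓ)
open import Relation.Binary.Construct.Closure.ReflexiveTransitive using (Star; ε; _◅_; _◅◅_; gmap)
open import Relation.Binary.Core using (Rel)
open import Relation.Binary.PropositionalEquality using (_≡_; _≢_; _≗_; refl; sym; trans; cong; cong₂; setoid) renaming (subst to ≡-subst; subst₂ to ≡-subst₂)
open import Relation.Nullary.Decidable using (yes; no; ¬?)
open import Relation.Nullary.Negation using (¬_)
open import Algebra.Properties.CommutativeSemigroup +-commutativeSemigroup using (xy∙z≈xz∙y)
open import Defs

-- De Bruijn terms and weak reduction under an environment

module DeBruijn where

  infixl 7 _∙_
  infixl 8 _⟦_⟧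

  -- De Bruijn terms; t ⟦ u ⟧ is the explicit substitution of u for index 0 of t.
  data Tm : Set where
    ix    : ℕ → Tm
    lam   : Tm → Tm
    _∙_   : Tm → Tm → Tm
    _⟦_⟧ : Tm → Tm → Tm

  ext : (ℕ → ℕ) → ℕ → ℕ
  ext ρ zero    = zero
  ext ρ (suc i) = suc (ρ i)

  ren : (ℕ → ℕ) → Tm → Tm
  ren ρ (ix i)     = ix (ρ i)
  ren ρ (lam t)    = lam (ren (ext ρ) t)
  ren ρ (t ∙ u)    = ren ρ t ∙ ren ρ u
  ren ρ (t ⟦ u ⟧) = ren (ext ρ) t ⟦ ren ρ u ⟧

  ↑ : Tm → Tm
  ↑ = ren suc

  private variable
    ρ ρ′ : ℕ → ℕ
    i m n n′ : ℕ
    a e r r′ s t t′ u u′ w : Tm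
    Δ Δ′ : List Tm

  ext-cong : ρ ≗ ρ′ → ext ρ ≗ ext ρ′
  ext-cong h zero    = refl
  ext-cong h (suc i) = cong suc (h i)

  ren-cong : ρ ≗ ρ′ → ren ρ ≗ ren ρ′
  ren-cong h (ix i)     = cong ix (h i)
  ren-cong h (lam t)    = cong lam (ren-cong (ext-cong h) t)
  ren-cong h (t ∙ u)    = cong₂ _∙_ (ren-cong h t) (ren-cong h u)
  ren-cong h (t ⟦ u ⟧) = cong₂ _⟦_⟧ (ren-cong (ext-cong h) t) (ren-cong h u)

  ext-∘ : ext ρ ∘ ext ρ′ ≗ ext (ρ ∘ ρ′)
  ext-∘ zero    = refl
  ext-∘ (suc i) = refl

  ren-∘ : ∀ t → ren ρ (ren ρ′ t) ≡ ren (ρ ∘ ρ′) t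
  ren-∘ (ix i)     = refl
  ren-∘ (lam t)    = cong lam (trans (ren-∘ t) (ren-cong ext-∘ t))
  ren-∘ (t ∙ u)    = cong₂ _∙_ (ren-∘ t) (ren-∘ u)
  ren-∘ (t ⟦ u ⟧) = cong₂ _⟦_⟧ (trans (ren-∘ t) (ren-cong ext-∘ t)) (ren-∘ u)

  ren-↑ : ∀ t → ren (ext ρ) (↑ t) ≡ ↑ (ren ρ t)
  ren-↑ t = trans (ren-∘ t) (sym (ren-∘ t))

  infix 4 _∋_↦_ _⊢_⟶_ _⊢_⟶*_

  data _∋_↦_ : List Tm → ℕ → Tm → Set where
    here  : u ∷ Δ ∋ zero ↦ ↑ u
    there : Δ ∋ i ↦ u → w ∷ Δ ∋ suc i ↦ ↑ u

  -- Mult t u r: t is S⟨λ.s⟩ and r is S⟨s[u]⟩, with u lifted over S.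
  data Mult : Tm → Tm → Tm → Set where
    lam : Mult (lam t) u (t ⟦ u ⟧)
    es  : Mult t (↑ u) r → Mult (t ⟦ s ⟧) u (r ⟦ s ⟧)

  -- Weak reduction of an open term: Δ lists the explicit substitutions that
  -- surround it, so that the exponential rule becomes the lookup of an index.
  data _⊢_⟶_ : List Tm → Tm → Tm → Set where
    look : Δ ∋ i ↦ u → Δ ⊢ ix i ⟶ u
    mult : Mult t u r → Δ ⊢ t ∙ u ⟶ r
    appˡ : Δ ⊢ t ⟶ t′ → Δ ⊢ t ∙ u ⟶ t′ ∙ u
    appʳ : Δ ⊢ u ⟶ u′ → Δ ⊢ t ∙ u ⟶ t ∙ u′
    esˡ  : u ∷ Δ ⊢ t ⟶ t′ → Δ ⊢ t ⟦ u ⟧ ⟶ t′ ⟦ u ⟧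
    esʳ  : Δ ⊢ u ⟶ u′ → Δ ⊢ t ⟦ u ⟧ ⟶ t ⟦ u′ ⟧

  _⊢_⟶*_ : List Tm → Tm → Tm → Set
  Δ ⊢ t ⟶* u = Star (Δ ⊢_⟶_) t u

  Mult-functional : Mult t u r → Mult t u r′ → r ≡ r′
  Mult-functional lam    lam    = refl
  Mult-functional (es p) (es q) = cong (_⟦ _ ⟧) (Mult-functional p q)

  Mult-resp : u ≡ u′ → Mult t u r → Mult t u′ r
  Mult-resp refl p = p

  Mult-ren : Mult t u r → Mult (ren ρ t) (ren ρ u) (ren ρ r)
  Mult-ren lam = lam
  Mult-ren {u = u} (es p) = es (Mult-resp (ren-↑ u) (Mult-ren p))

  Mult-ren⁻¹ : ∀ t {u} → Mult (ren ρ t) (ren ρ u) r → ∃[ r′ ] (r ≡ ren ρ r′ × Mult t u r′)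
  Mult-ren⁻¹ (lam t) lam = _ , refl , lam
  Mult-ren⁻¹ (t ⟦ s ⟧) {u} (es p)
    with r′ , refl , q ← Mult-ren⁻¹ t (Mult-resp (sym (ren-↑ u)) p)
    = _ , refl , es q

  RenEnv : (ℕ → ℕ) → List Tm → List Tm → Set
  RenEnv ρ Δ Δ′ = ∀ {i u} → Δ ∋ i ↦ u → Δ′ ∋ ρ i ↦ ren ρ u

  RenEnv-ext : RenEnv ρ Δ Δ′ → RenEnv (ext ρ) (u ∷ Δ) (ren ρ u ∷ Δ′)
  RenEnv-ext {ρ} {u = u} h here rewrite ren-↑ {ρ} u = here
  RenEnv-ext {ρ} h (there {u = u} p) rewrite ren-↑ {ρ} u = there (h p)

  ⟶-ren : RenEnv ρ Δ Δ′ → Δ ⊢ t ⟶ t′ → Δ′ ⊢ ren ρ t ⟶ ren ρ t′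
  ⟶-ren h (look p) = look (h p)
  ⟶-ren h (mult p) = mult (Mult-ren p)
  ⟶-ren h (appˡ p) = appˡ (⟶-ren h p)
  ⟶-ren h (appʳ p) = appʳ (⟶-ren h p)
  ⟶-ren h (esˡ p)  = esˡ (⟶-ren (RenEnv-ext h) p)
  ⟶-ren h (esʳ p)  = esʳ (⟶-ren h p)

  -- The converse of `RenEnv`: an index in the image of `ρ` finds in `Δ′` only renamings of entries
  -- of `Δ`, so a step of a renamed term comes from the term itself.
  RenEnv⁻¹ : (ℕ → ℕ) → List Tm → List Tm → Set
  RenEnv⁻¹ ρ Δ Δ′ = ∀ i {w} → Δ′ ∋ ρ i ↦ w → ∃[ u ] (w ≡ ren ρ u × Δ ∋ i ↦ u)

  RenEnv⁻¹-ext : RenEnv⁻¹ ρ Δ Δ′ → RenEnv⁻¹ (ext ρ) (u ∷ Δ) (ren ρ u ∷ Δ′)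
  RenEnv⁻¹-ext {u = u} h zero here = _ , sym (ren-↑ u) , here
  RenEnv⁻¹-ext h (suc i) (there p) with u , refl , q ← h i p = _ , sym (ren-↑ u) , there q

  ⟶-ren⁻¹ : RenEnv⁻¹ ρ Δ Δ′ → ∀ t → Δ′ ⊢ ren ρ t ⟶ e → ∃[ t′ ] (e ≡ ren ρ t′ × Δ ⊢ t ⟶ t′)
  ⟶-ren⁻¹ h (ix i) (look p) with u , refl , q ← h i p = u , refl , look q
  ⟶-ren⁻¹ h (t ∙ u) (mult p) with r , refl , q ← Mult-ren⁻¹ t p = r , refl , mult q
  ⟶-ren⁻¹ h (t ∙ u) (appˡ p) with t′ , refl , q ← ⟶-ren⁻¹ h t p = _ , refl , appˡ q
  ⟶-ren⁻¹ h (t ∙ u) (appʳ p) with u′ , refl , q ← ⟶-ren⁻¹ h u p = _ , refl , appʳ q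
  ⟶-ren⁻¹ h (t ⟦ u ⟧) (esˡ p) with t′ , refl , q ← ⟶-ren⁻¹ (RenEnv⁻¹-ext h) t p = _ , refl , esˡ q
  ⟶-ren⁻¹ h (t ⟦ u ⟧) (esʳ p) with u′ , refl , q ← ⟶-ren⁻¹ h u p = _ , refl , esʳ q

  ⟶-↑ : Δ ⊢ t ⟶ t′ → w ∷ Δ ⊢ ↑ t ⟶ ↑ t′
  ⟶-↑ = ⟶-ren there

  ⟶-↑⁻¹ : ∀ t → w ∷ Δ ⊢ ↑ t ⟶ e → ∃[ t′ ] (e ≡ ↑ t′ × Δ ⊢ t ⟶ t′)
  ⟶-↑⁻¹ = ⟶-ren⁻¹ λ { i (there p) → _ , refl , p }

  -- Weak steps never enter the abstraction, so the step lies in one of the substitutions around it,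
  -- and contraction keeps these.
  Mult-⟶ˡ : Mult t u r → Δ ⊢ t ⟶ t′ → ∃[ r′ ] (Mult t′ u r′ × Δ ⊢ r ⟶ r′)
  Mult-⟶ˡ (es p) (esˡ q) with _ , p′ , q′ ← Mult-⟶ˡ p q = _ , es p′ , esˡ q′
  Mult-⟶ˡ (es p) (esʳ q) = _ , es p , esʳ q

  Mult-⟶ʳ : Mult t u r → Δ ⊢ u ⟶ u′ → ∃[ r′ ] (Mult t u′ r′ × Δ ⊢ r ⟶ r′)
  Mult-⟶ʳ lam q = _ , lam , esʳ q
  Mult-⟶ʳ (es p) q with _ , p′ , q′ ← Mult-⟶ʳ p (⟶-↑ q) = _ , es p′ , esˡ q′

  Mult-⟶*ˡ : Mult t u r → Δ ⊢ t ⟶* t′ → ∃[ r′ ] (Mult t′ u r′ × Δ ⊢ r ⟶* r′)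
  Mult-⟶*ˡ p ε = _ , p , ε
  Mult-⟶*ˡ p (q ◅ qs) with _ , p′ , q′ ← Mult-⟶ˡ p q with _ , p″ , qs′ ← Mult-⟶*ˡ p′ qs = _ , p″ , q′ ◅ qs′

  Mult-⟶*ʳ : Mult t u r → Δ ⊢ u ⟶* u′ → ∃[ r′ ] (Mult t u′ r′ × Δ ⊢ r ⟶* r′)
  Mult-⟶*ʳ p ε = _ , p , ε
  Mult-⟶*ʳ p (q ◅ qs) with _ , p′ , q′ ← Mult-⟶ʳ p q with _ , p″ , qs′ ← Mult-⟶*ʳ p′ qs = _ , p″ , q′ ◅ qs′

  -- Parallel reduction with step counts

  -- An entry (n , u′) stands for a substitution whose content reduces to u′ in n steps.
  PEnv : Set
  PEnv = List (ℕ × Tm)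

  targets : PEnv → List Tm
  targets = map proj₂

  infix 4 _∋_↦⟨_⟩_ _⊢_⇉⟨_⟩_

  data _∋_↦⟨_⟩_ : PEnv → ℕ → ℕ → Tm → Set where
    here  : ∀ {P} → (n , u) ∷ P ∋ zero ↦⟨ n ⟩ ↑ u
    there : ∀ {P p} → P ∋ i ↦⟨ n ⟩ u → p ∷ P ∋ suc i ↦⟨ n ⟩ ↑ u

  private variable
    P P′ : PEnv

  -- P ⊢ t ⇉⟨ n ⟩ t′: t reduces to t′ in n steps when every substitution content is
  -- reduced after having been copied to the indices that are replaced.
  data _⊢_⇉⟨_⟩_ : PEnv → Tm → ℕ → Tm → Set where
    ix   : P ⊢ ix i ⇉⟨ 0 ⟩ ix i
    look : P ∋ i ↦⟨ n ⟩ u → P ⊢ ix i ⇉⟨ suc n ⟩ u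
    lam  : P ⊢ lam t ⇉⟨ 0 ⟩ lam t
    app  : P ⊢ t ⇉⟨ n ⟩ t′ → P ⊢ u ⇉⟨ m ⟩ u′ → P ⊢ t ∙ u ⇉⟨ n + m ⟩ t′ ∙ u′
    mult : P ⊢ t ⇉⟨ n ⟩ t′ → P ⊢ u ⇉⟨ m ⟩ u′ → Mult t′ u′ r → P ⊢ t ∙ u ⇉⟨ suc (n + m) ⟩ r
    es   : (m , u′) ∷ P ⊢ t ⇉⟨ n ⟩ t′ → P ⊢ u ⇉⟨ m ⟩ u′ → P ⊢ t ⟦ u ⟧ ⇉⟨ n + m ⟩ t′ ⟦ u′ ⟧

  ∋⟨⟩-functional : P ∋ i ↦⟨ n ⟩ u → P ∋ i ↦⟨ n′ ⟩ u′ → n ≡ n′ × u ≡ u′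
  ∋⟨⟩-functional here      here      = refl , refl
  ∋⟨⟩-functional (there p) (there q) with refl , refl ← ∋⟨⟩-functional p q = refl , refl

  ∋-targets : P ∋ i ↦⟨ n ⟩ u → targets P ∋ i ↦ u
  ∋-targets here      = here
  ∋-targets (there p) = there (∋-targets p)

  RenPEnv : (ℕ → ℕ) → PEnv → PEnv → Set
  RenPEnv ρ P P′ = ∀ {i n u} → P ∋ i ↦⟨ n ⟩ u → P′ ∋ ρ i ↦⟨ n ⟩ ren ρ u

  RenPEnv-ext : RenPEnv ρ P P′ → RenPEnv (ext ρ) ((n , u) ∷ P) ((n , ren ρ u) ∷ P′)
  RenPEnv-ext {ρ} {u = u} h here rewrite ren-↑ {ρ} u = here
  RenPEnv-ext {ρ} h (there {u = u} p) rewrite ren-↑ {ρ} u = there (h p)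

  ⇉-ren : RenPEnv ρ P P′ → P ⊢ t ⇉⟨ n ⟩ t′ → P′ ⊢ ren ρ t ⇉⟨ n ⟩ ren ρ t′
  ⇉-ren h ix           = ix
  ⇉-ren h (look p)     = look (h p)
  ⇉-ren h lam          = lam
  ⇉-ren h (app p q)    = app (⇉-ren h p) (⇉-ren h q)
  ⇉-ren h (mult p q x) = mult (⇉-ren h p) (⇉-ren h q) (Mult-ren x)
  ⇉-ren h (es p q)     = es (⇉-ren (RenPEnv-ext h) p) (⇉-ren h q)

  ⇉-↑ : ∀ {p} → P ⊢ t ⇉⟨ n ⟩ t′ → p ∷ P ⊢ ↑ t ⇉⟨ n ⟩ ↑ t′
  ⇉-↑ = ⇉-ren there

  ⇉-refl : ∀ t → P ⊢ t ⇉⟨ 0 ⟩ t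
  ⇉-refl (ix _)     = ix
  ⇉-refl (lam _)    = lam
  ⇉-refl (t ∙ u)    = app (⇉-refl t) (⇉-refl u)
  ⇉-refl (t ⟦ u ⟧) = es (⇉-refl t) (⇉-refl u)

  -- Contraction copies nothing: the argument becomes a content, whose steps are counted as before,
  -- and the body of the abstraction stands still. Hence the count stays `n + m`.
  ⇉-Mult : Mult t u r → P ⊢ t ⇉⟨ n ⟩ t′ → P ⊢ u ⇉⟨ m ⟩ u′ →
           ∃[ r′ ] (Mult t′ u′ r′ × P ⊢ r ⇉⟨ n + m ⟩ r′)
  ⇉-Mult lam lam q = _ , lam , es (⇉-refl _) q
  ⇉-Mult {m = m} (es x) (es {m = m₁} {n = n₁} p p₁) q
    with _ , x′ , p′ ← ⇉-Mult x p (⇉-↑ q)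
    rewrite xy∙z≈xz∙y n₁ m₁ m
    = _ , es x′ , es p′ p₁

  -- When the target of a content moves on, the copies of the old target made by the parallel step
  -- can follow it.
  ⇉-retarget : (∀ {i n u} → P ∋ i ↦⟨ n ⟩ u → ∃[ n′ ] ∃[ u′ ] (P′ ∋ i ↦⟨ n′ ⟩ u′ × targets P ⊢ u ⟶* u′)) →
               P ⊢ t ⇉⟨ n ⟩ t′ → ∃[ n′ ] ∃[ t″ ] (P′ ⊢ t ⇉⟨ n′ ⟩ t″ × targets P ⊢ t′ ⟶* t″)
  ⇉-retarget h ix = _ , _ , ix , ε
  ⇉-retarget h (look p) with _ , _ , q , s ← h p = _ , _ , look q , s
  ⇉-retarget h lam = _ , _ , lam , ε
  ⇉-retarget h (app p q)
    with _ , _ , p′ , ss ← ⇉-retarget h p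
    with _ , _ , q′ , ss′ ← ⇉-retarget h q
    = _ , _ , app p′ q′ , gmap (_∙ _) appˡ ss ◅◅ gmap (_ ∙_) appʳ ss′
  ⇉-retarget h (mult p q x)
    with _ , _ , p′ , ss ← ⇉-retarget h p
    with _ , _ , q′ , ss′ ← ⇉-retarget h q
    with _ , x′ , rs ← Mult-⟶*ˡ x ss
    with _ , x″ , rs′ ← Mult-⟶*ʳ x′ ss′
    = _ , _ , mult p′ q′ x″ , rs ◅◅ rs′
  ⇉-retarget h (es p q)
    with _ , _ , q′ , ss′ ← ⇉-retarget h q
    with _ , _ , p′ , ss ← ⇉-retarget (λ { here → _ , _ , here , gmap ↑ ⟶-↑ ss′
                                         ; (there x) → let _ , _ , y , ss = h x in _ , _ , there y , gmap ↑ ⟶-↑ ss }) p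
    -- The copies move first, while the content is still the old target; the content itself moves
    -- last.
    = _ , _ , es p′ q′ , gmap (_⟦ _ ⟧) esˡ ss ◅◅ gmap (_ ⟦_⟧) esʳ ss′

  -- Used when a content has already made some of its counted steps: each lookup of it then costs no
  -- more than before.
  ⇉-lower : (∀ {i n u} → P ∋ i ↦⟨ n ⟩ u → ∃[ n′ ] (n′ ≤ n × P′ ∋ i ↦⟨ n′ ⟩ u)) →
            P ⊢ t ⇉⟨ n ⟩ t′ → ∃[ n′ ] (n′ ≤ n × P′ ⊢ t ⇉⟨ n′ ⟩ t′)
  ⇉-lower h ix = _ , ≤-refl , ix
  ⇉-lower h (look p) with _ , le , q ← h p = _ , s≤s le , look q
  ⇉-lower h lam = _ , ≤-refl , lam
  ⇉-lower h (app p q)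
    with _ , le , p′ ← ⇉-lower h p
    with _ , le′ , q′ ← ⇉-lower h q
    = _ , +-mono-≤ le le′ , app p′ q′
  ⇉-lower h (mult p q x)
    with _ , le , p′ ← ⇉-lower h p
    with _ , le′ , q′ ← ⇉-lower h q
    = _ , s≤s (+-mono-≤ le le′) , mult p′ q′ x
  ⇉-lower h (es p q)
    with _ , le′ , q′ ← ⇉-lower h q
    with _ , le , p′ ← ⇉-lower (λ { here → _ , le′ , here
                                  ; (there x) → let _ , le , y = h x in _ , le , there y }) p
    = _ , +-mono-≤ le le′ , es p′ q′

  -- `Δ` and `P` are the two sides of one parallel step: each content in `Δ` makes the step whose
  -- count and target are recorded in `P`.
  Compatible : List Tm → PEnv → Set
  Compatible Δ P = ∀ {i u} → Δ ∋ i ↦ u → ∃[ n ] ∃[ u′ ] (P ∋ i ↦⟨ n ⟩ u′ × P ⊢ u ⇉⟨ n ⟩ u′)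

  Compatible-∷ : Compatible Δ P → P ⊢ u ⇉⟨ n ⟩ u′ → Compatible (u ∷ Δ) ((n , u′) ∷ P)
  Compatible-∷ c p here = _ , _ , here , ⇉-↑ p
  Compatible-∷ c p (there x) with _ , _ , y , q ← c x = _ , _ , there y , ⇉-↑ q

  _⊢_⟶⁺_ : List Tm → Tm → Tm → Set
  Δ ⊢ t ⟶⁺ u = ∃[ s ] (Δ ⊢ t ⟶ s × Δ ⊢ s ⟶* u)

  ⟶⁺-map : (f : Tm → Tm) → (∀ {t u} → Δ ⊢ t ⟶ u → Δ′ ⊢ f t ⟶ f u) → Δ ⊢ t ⟶⁺ u → Δ′ ⊢ f t ⟶⁺ f u
  ⟶⁺-map f g (_ , s , ss) = _ , g s , gmap f g ss

  _◅◅⁺_ : Δ ⊢ t ⟶* s → Δ ⊢ s ⟶⁺ u → Δ ⊢ t ⟶⁺ u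
  ε        ◅◅⁺ q           = q
  (p ◅ ps) ◅◅⁺ (_ , q , qs) = _ , p , ps ◅◅ (q ◅ qs)

  -- A parallel step t ⇉ t′ is projected over t ⟶ u. As nothing is ever erased, t′ makes
  -- at least one step unless t ⟶ u is one of the steps counted by t ⇉ t′.
  ⇉-project : Compatible Δ P → P ⊢ t ⇉⟨ n ⟩ t′ → Δ ⊢ t ⟶ u →
              ∃[ n′ ] ∃[ u′ ] (P ⊢ u ⇉⟨ n′ ⟩ u′ × (targets P ⊢ t′ ⟶⁺ u′ ⊎ (u′ ≡ t′ × n′ < n)))
  -- The parallel step left the index alone, so its result copies the target, and the content copied
  -- by the other step catches up.
  ⇉-project c ix (look x) with _ , _ , y , p ← c x = _ , _ , p , inj₁ (_ , look (∋-targets y) , ε)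
  ⇉-project c (look z) (look x)
    with _ , _ , y , p ← c x
    with refl , refl ← ∋⟨⟩-functional y z
    -- The lookup was itself counted; the steps of the copied content remain.
    = _ , _ , p , inj₂ (refl , n<1+n _)
  ⇉-project c (app p q) (appˡ s) with ⇉-project c p s
  ... | _ , _ , p′ , inj₁ ss          = _ , _ , app p′ q , inj₁ (⟶⁺-map (_∙ _) appˡ ss)
  ... | _ , _ , p′ , inj₂ (refl , lt) = _ , _ , app p′ q , inj₂ (refl , +-monoˡ-< _ lt)
  ⇉-project c (app p q) (appʳ s) with ⇉-project c q s
  ... | _ , _ , q′ , inj₁ ss          = _ , _ , app p q′ , inj₁ (⟶⁺-map (_ ∙_) appʳ ss)
  ... | _ , _ , q′ , inj₂ (refl , lt) = _ , _ , app p q′ , inj₂ (refl , +-monoʳ-< _ lt)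
  ⇉-project c (app p q) (mult x) with _ , x′ , p′ ← ⇉-Mult x p q = _ , _ , p′ , inj₁ (_ , mult x′ , ε)
  ⇉-project c (mult p q x) (appˡ s) with ⇉-project c p s
  ... | _ , _ , p′ , inj₂ (refl , lt) = _ , _ , mult p′ q x , inj₂ (refl , s≤s (+-monoˡ-< _ lt))
  ... | _ , _ , p′ , inj₁ (_ , s₁ , ss)
    with _ , x₁ , r₁ ← Mult-⟶ˡ x s₁
    with _ , x₂ , rs ← Mult-⟶*ˡ x₁ ss
    = _ , _ , mult p′ q x₂ , inj₁ (_ , r₁ , rs)
  ⇉-project c (mult p q x) (appʳ s) with ⇉-project c q s
  ... | _ , _ , q′ , inj₂ (refl , lt) = _ , _ , mult p q′ x , inj₂ (refl , s≤s (+-monoʳ-< _ lt))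
  ... | _ , _ , q′ , inj₁ (_ , s₁ , ss)
    with _ , x₁ , r₁ ← Mult-⟶ʳ x s₁
    with _ , x₂ , rs ← Mult-⟶*ʳ x₁ ss
    = _ , _ , mult p q′ x₂ , inj₁ (_ , r₁ , rs)
  ⇉-project c (mult p q x) (mult y)
    with _ , y′ , p′ ← ⇉-Mult y p q
    with refl ← Mult-functional x y′
    = _ , _ , p′ , inj₂ (refl , n<1+n _)
  ⇉-project c (es p q) (esˡ s) with ⇉-project (Compatible-∷ c q) p s
  ... | _ , _ , p′ , inj₁ ss          = _ , _ , es p′ q , inj₁ (⟶⁺-map (_⟦ _ ⟧) esˡ ss)
  ... | _ , _ , p′ , inj₂ (refl , lt) = _ , _ , es p′ q , inj₂ (refl , +-monoˡ-< _ lt)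
  ⇉-project c (es p q) (esʳ s) with ⇉-project c q s
  ... | _ , _ , q′ , inj₁ ss
    with _ , _ , p′ , ts ← ⇉-retarget (λ { here → _ , _ , here , gmap ↑ ⟶-↑ (proj₁ (proj₂ ss) ◅ proj₂ (proj₂ ss))
                                         ; (there x) → _ , _ , there x , ε }) p
    -- There may be no copy to update, so `ts` may be empty; the content itself supplies the step
    -- that `⟶⁺` asks for.
    = _ , _ , es p′ q′ , inj₁ (gmap (_⟦ _ ⟧) esˡ ts ◅◅⁺ ⟶⁺-map (_ ⟦_⟧) esʳ ss)
  ... | _ , _ , q′ , inj₂ (refl , lt)
    with _ , le , p′ ← ⇉-lower (λ { here → _ , <⇒≤ lt , here ; (there x) → _ , ≤-refl , there x }) p
    -- The content's own count falls strictly, which makes the total fall even when no copy of it is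
    -- made.
    = _ , _ , es p′ q′ , inj₂ (refl , +-mono-≤-< le lt)

  -- A counted lookup can be made at once, and a counted contraction as soon as its two parts are
  -- unchanged by the parallel step.
  ⇉-progress : (∀ {i n u} → P ∋ i ↦⟨ n ⟩ u → ∃[ s ] (Δ ∋ i ↦ s)) →
               P ⊢ t ⇉⟨ n ⟩ t′ → t ≡ t′ ⊎ ∃[ u ] (Δ ⊢ t ⟶ u)
  ⇉-progress h ix = inj₁ refl
  ⇉-progress h (look x) = inj₂ (_ , look (proj₂ (h x)))
  ⇉-progress h lam = inj₁ refl
  ⇉-progress h (app p q) with ⇉-progress h p | ⇉-progress h q
  ... | inj₂ (_ , s) | _            = inj₂ (_ , appˡ s)
  ... | inj₁ _       | inj₂ (_ , s) = inj₂ (_ , appʳ s)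
  ... | inj₁ refl    | inj₁ refl    = inj₁ refl
  ⇉-progress h (mult p q x) with ⇉-progress h p | ⇉-progress h q
  ... | inj₂ (_ , s) | _            = inj₂ (_ , appˡ s)
  ... | inj₁ _       | inj₂ (_ , s) = inj₂ (_ , appʳ s)
  ... | inj₁ refl    | inj₁ refl    = inj₂ (_ , mult x)
  ⇉-progress h (es p q)
    with ⇉-progress (λ { here → _ , here ; (there x) → _ , there (proj₂ (h x)) }) p | ⇉-progress h q
  ... | inj₂ (_ , s) | _            = inj₂ (_ , esˡ s)
  ... | inj₁ _       | inj₂ (_ , s) = inj₂ (_ , esʳ s)
  ... | inj₁ refl    | inj₁ refl    = inj₁ refl

  -- A lookup copies its content as it stands, hence the entries of count 0.
  ⟶⇒⇉ : (∀ {i u} → Δ ∋ i ↦ u → P ∋ i ↦⟨ 0 ⟩ u) → Δ ⊢ t ⟶ u → ∃[ n ] (P ⊢ t ⇉⟨ n ⟩ u)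
  ⟶⇒⇉ h (look x) = _ , look (h x)
  ⟶⇒⇉ h (mult x) = _ , mult (⇉-refl _) (⇉-refl _) x
  ⟶⇒⇉ h (appˡ s) = _ , app (proj₂ (⟶⇒⇉ h s)) (⇉-refl _)
  ⟶⇒⇉ h (appʳ s) = _ , app (⇉-refl _) (proj₂ (⟶⇒⇉ h s))
  ⟶⇒⇉ h (esˡ s)  = _ , es (proj₂ (⟶⇒⇉ (λ { here → here ; (there x) → there (h x) }) s)) (⇉-refl _)
  ⟶⇒⇉ h (esʳ s)  = _ , es (⇉-refl _) (proj₂ (⟶⇒⇉ h s))

  -- Strong normalisation with a unique normal form

  Normal : Tm → Set
  Normal t = ∀ {u} → ¬ ([] ⊢ t ⟶ u)

  -- t is strongly normalising and a is its only possible normal form.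
  data Evaluates (a t : Tm) : Set where
    eval : (∀ {u} → [] ⊢ t ⟶ u → Evaluates a u) → (Normal t → t ≡ a) → Evaluates a t

  Evaluates-normal : Evaluates a t → Normal t → t ≡ a
  Evaluates-normal (eval _ nf) = nf

  -- Lexicographic induction on the evaluation of `s`, then on the count. Carrying the reduction
  -- from `s` to `t′` lets the evaluation of `t′` be reached by descending inside that of `s`. A
  -- normal `t` equals `t′` by `⇉-progress`.
  Evaluates-⇉⁻¹ : Evaluates a s → [] ⊢ s ⟶* t′ → Acc _<_ n → [] ⊢ t ⇉⟨ n ⟩ t′ → Evaluates a t
  Evaluates-⇉⁻¹ (eval h _) (q ◅ qs) rs p = Evaluates-⇉⁻¹ (h q) qs rs p
  Evaluates-⇉⁻¹ {a = a} {t = t} v ε (acc rs) p = eval (next v) last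
    where
    next : Evaluates a _ → ∀ {u} → [] ⊢ t ⟶ u → Evaluates a u
    next v q with ⇉-project (λ ()) p q
    next (eval h _) q | _ , _ , p′ , inj₁ (_ , x , xs) = Evaluates-⇉⁻¹ (h x) xs (<-wellFounded _) p′
    next v          q | _ , _ , p′ , inj₂ (refl , lt)  = Evaluates-⇉⁻¹ v ε (rs lt) p′
    last : Normal t → t ≡ a
    last nt with ⇉-progress (λ ()) p
    ... | inj₁ refl    = Evaluates-normal v nt
    ... | inj₂ (_ , q) = ⊥-elim (nt q)

  Normal⇒Evaluates : Normal a → Evaluates a a
  Normal⇒Evaluates na = eval (λ q → ⊥-elim (na q)) (λ _ → refl)

  Evaluates-⟶*⁻¹ : [] ⊢ t ⟶* u → Evaluates a u → Evaluates a t
  Evaluates-⟶*⁻¹ ε        v = v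
  Evaluates-⟶*⁻¹ (q ◅ qs) v =
    Evaluates-⇉⁻¹ (Evaluates-⟶*⁻¹ qs v) ε (<-wellFounded _) (proj₂ (⟶⇒⇉ (λ ()) q))

  -- Structural reductions

  data Ans : Tm → Set where
    lam : Ans (lam t)
    es  : Ans t → Ans u → Ans (t ⟦ u ⟧)

  Ans-ren : Ans t → Ans (ren ρ t)
  Ans-ren lam      = lam
  Ans-ren (es p q) = es (Ans-ren p) (Ans-ren q)

  Ans-normal : Ans t → ¬ (Δ ⊢ t ⟶ u)
  Ans-normal (es p q) (esˡ s) = Ans-normal p s
  Ans-normal (es p q) (esʳ s) = Ans-normal q s

  infix 4 _⇝ˡ_ _⇝ᵃ_ _⇝ˡ*_ _⇝ᵃ*_ _⇛ᵈ_

  data _⇝ˡ_ : Tm → Tm → Set where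
    root : t ⟦ u ⟧ ∙ s ⇝ˡ (t ∙ ↑ s) ⟦ u ⟧
    appˡ : t ⇝ˡ t′ → t ∙ u ⇝ˡ t′ ∙ u
    appʳ : u ⇝ˡ u′ → t ∙ u ⇝ˡ t ∙ u′
    esˡ  : t ⇝ˡ t′ → t ⟦ u ⟧ ⇝ˡ t′ ⟦ u ⟧
    esʳ  : u ⇝ˡ u′ → t ⟦ u ⟧ ⇝ˡ t ⟦ u′ ⟧

  -- The extruded substitution comes to surround `a`, just outside its own index 0; `ren (ext suc)`
  -- fixes that index and shifts the others.
  data _⇝ᵃ_ : Tm → Tm → Set where
    root : Ans a → a ⟦ t ⟦ u ⟧ ⟧ ⇝ᵃ ren (ext suc) a ⟦ t ⟧ ⟦ u ⟧
    esˡ  : t ⇝ᵃ t′ → t ⟦ u ⟧ ⇝ᵃ t′ ⟦ u ⟧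

  _⇝ˡ*_ _⇝ᵃ*_ _⇛ᵈ_ : Tm → Tm → Set
  _⇝ˡ*_ = Star _⇝ˡ_
  _⇝ᵃ*_ = Star _⇝ᵃ_
  t ⇛ᵈ u = ∃[ s ] (t ⇝ˡ* s × s ⇝ᵃ* u)

  Ans-¬⇝ˡ : Ans t → ¬ (t ⇝ˡ u)
  Ans-¬⇝ˡ (es p q) (esˡ s) = Ans-¬⇝ˡ p s
  Ans-¬⇝ˡ (es p q) (esʳ s) = Ans-¬⇝ˡ q s

  ⇝ˡ-Ans⁻¹ : t ⇝ˡ u → Ans u → Ans t
  ⇝ˡ-Ans⁻¹ (esˡ s) (es p q) = es (⇝ˡ-Ans⁻¹ s p) q
  ⇝ˡ-Ans⁻¹ (esʳ s) (es p q) = es p (⇝ˡ-Ans⁻¹ s q)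

  ⇝ᵃ-Ans⁻¹ : t ⇝ᵃ u → Ans u → Ans t
  ⇝ᵃ-Ans⁻¹ (root x) (es (es p q) r) = es x (es q r)
  ⇝ᵃ-Ans⁻¹ (esˡ s) (es p q) = es (⇝ᵃ-Ans⁻¹ s p) q

  ⇛ᵈ-Ans⁻¹ : t ⇛ᵈ u → Ans u → Ans t
  ⇛ᵈ-Ans⁻¹ (_ , ls , as) x = along ⇝ˡ-Ans⁻¹ ls (along ⇝ᵃ-Ans⁻¹ as x)
    where
    along : ∀ {R : Tm → Tm → Set} → (∀ {t u} → R t u → Ans u → Ans t) → Star R t u → Ans u → Ans t
    along f ε        x = x
    along f (p ◅ ps) x = f p (along f ps x)

  ⇝ˡ-ren : t ⇝ˡ u → ren ρ t ⇝ˡ ren ρ u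
  ⇝ˡ-ren {ρ = ρ} (root {t} {u} {s}) = ≡-subst (λ z → ren ρ (t ⟦ u ⟧ ∙ s) ⇝ˡ (ren (ext ρ) t ∙ z) ⟦ ren ρ u ⟧) (sym (ren-↑ s)) root
  ⇝ˡ-ren (appˡ p) = appˡ (⇝ˡ-ren p)
  ⇝ˡ-ren (appʳ p) = appʳ (⇝ˡ-ren p)
  ⇝ˡ-ren (esˡ p)  = esˡ (⇝ˡ-ren p)
  ⇝ˡ-ren (esʳ p)  = esʳ (⇝ˡ-ren p)

  Mult-⇝ˡ⁻¹ : Mult t′ u r → t ⇝ˡ t′ → ∃[ r′ ] (Mult t u r′ × r′ ⇝ˡ r)
  Mult-⇝ˡ⁻¹ (es x) (esˡ p) with _ , x′ , q ← Mult-⇝ˡ⁻¹ x p = _ , es x′ , esˡ q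
  Mult-⇝ˡ⁻¹ (es x) (esʳ p) = _ , es x , esʳ p

  Mult-⇝ʳ⁻¹ : Mult t u′ r → u ⇝ˡ u′ → ∃[ r′ ] (Mult t u r′ × r′ ⇝ˡ r)
  Mult-⇝ʳ⁻¹ lam    p = _ , lam , esʳ p
  Mult-⇝ʳ⁻¹ (es x) p with _ , x′ , q ← Mult-⇝ʳ⁻¹ x (⇝ˡ-ren p) = _ , es x′ , esˡ q

  -- For a lookup of a content that `⇝ˡ` has changed: the original content is copied instead, and
  -- the copy is changed afterwards. This is why the diagrams close with `⇝ˡ*`.
  ⟶-env-⇝ˡ : (∀ {i u} → Δ′ ∋ i ↦ u → ∃[ u′ ] (Δ ∋ i ↦ u′ × u′ ⇝ˡ* u)) →
             Δ′ ⊢ t ⟶ r → ∃[ r′ ] (Δ ⊢ t ⟶ r′ × r′ ⇝ˡ* r)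
  ⟶-env-⇝ˡ h (look x) with _ , y , ls ← h x = _ , look y , ls
  ⟶-env-⇝ˡ h (mult x) = _ , mult x , ε
  ⟶-env-⇝ˡ h (appˡ s) with _ , s′ , ls ← ⟶-env-⇝ˡ h s = _ , appˡ s′ , gmap (_∙ _) appˡ ls
  ⟶-env-⇝ˡ h (appʳ s) with _ , s′ , ls ← ⟶-env-⇝ˡ h s = _ , appʳ s′ , gmap (_ ∙_) appʳ ls
  ⟶-env-⇝ˡ h (esˡ s)
    with _ , s′ , ls ← ⟶-env-⇝ˡ (λ { here → _ , here , ε ; (there x) → let _ , y , ls = h x in _ , there y , gmap ↑ ⇝ˡ-ren ls }) s
    = _ , esˡ s′ , gmap (_⟦ _ ⟧) esˡ ls
  ⟶-env-⇝ˡ h (esʳ s) with _ , s′ , ls ← ⟶-env-⇝ˡ h s = _ , esʳ s′ , gmap (_ ⟦_⟧) esʳ ls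

  -- Extrusion creates no redex: `mult` acts through substitutions, so a redex it brings together
  -- was one already, and the lifted argument cannot refer to the substitution it has entered.
  ⇝ˡ-⟶ : s ⇝ˡ t → Δ ⊢ t ⟶ u → ∃[ r ] (Δ ⊢ s ⟶ r × r ⇝ˡ* u)
  ⇝ˡ-⟶ root (esˡ (mult x)) = _ , mult (es x) , ε
  ⇝ˡ-⟶ root (esˡ (appˡ p)) = _ , appˡ (esˡ p) , root ◅ ε
  ⇝ˡ-⟶ (root {s = s}) (esˡ (appʳ p)) with _ , refl , q ← ⟶-↑⁻¹ s p = _ , appʳ q , root ◅ ε
  ⇝ˡ-⟶ root (esʳ p) = _ , appˡ (esʳ p) , root ◅ ε
  ⇝ˡ-⟶ (appˡ l) (mult x) with _ , x′ , q ← Mult-⇝ˡ⁻¹ x l = _ , mult x′ , q ◅ ε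
  ⇝ˡ-⟶ (appˡ l) (appˡ p) with _ , p′ , ls ← ⇝ˡ-⟶ l p = _ , appˡ p′ , gmap (_∙ _) appˡ ls
  ⇝ˡ-⟶ (appˡ l) (appʳ p) = _ , appʳ p , appˡ l ◅ ε
  ⇝ˡ-⟶ (appʳ l) (mult x) with _ , x′ , q ← Mult-⇝ʳ⁻¹ x l = _ , mult x′ , q ◅ ε
  ⇝ˡ-⟶ (appʳ l) (appˡ p) = _ , appˡ p , appʳ l ◅ ε
  ⇝ˡ-⟶ (appʳ l) (appʳ p) with _ , p′ , ls ← ⇝ˡ-⟶ l p = _ , appʳ p′ , gmap (_ ∙_) appʳ ls
  ⇝ˡ-⟶ (esˡ l) (esˡ p) with _ , p′ , ls ← ⇝ˡ-⟶ l p = _ , esˡ p′ , gmap (_⟦ _ ⟧) esˡ ls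
  ⇝ˡ-⟶ (esˡ l) (esʳ p) = _ , esʳ p , esˡ l ◅ ε
  ⇝ˡ-⟶ (esʳ l) (esˡ p)
    with _ , p′ , ls ← ⟶-env-⇝ˡ (λ { here → _ , here , ⇝ˡ-ren l ◅ ε ; (there x) → _ , there x , ε }) p
    = _ , esˡ p′ , gmap (_⟦ _ ⟧) esˡ ls ◅◅ (esʳ l ◅ ε)
  ⇝ˡ-⟶ (esʳ l) (esʳ p) with _ , p′ , ls ← ⇝ˡ-⟶ l p = _ , esʳ p′ , gmap (_ ⟦_⟧) esʳ ls

  -- The term that enters the scope of the extruded substitution is an answer and has no steps, so
  -- only steps inside contents have to be moved.
  ⇝ᵃ-⟶ : s ⇝ᵃ t → Δ ⊢ t ⟶ u → ∃[ r ] (Δ ⊢ s ⟶ r × r ⇝ᵃ u)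
  ⇝ᵃ-⟶ (root x) (esˡ (esˡ p)) = ⊥-elim (Ans-normal (Ans-ren x) p)
  ⇝ᵃ-⟶ (root x) (esˡ (esʳ p)) = _ , esʳ (esˡ p) , root x
  ⇝ᵃ-⟶ (root x) (esʳ p)       = _ , esʳ (esʳ p) , root x
  ⇝ᵃ-⟶ (esˡ l) (esˡ p) with _ , p′ , l′ ← ⇝ᵃ-⟶ l p = _ , esˡ p′ , esˡ l′
  ⇝ᵃ-⟶ (esˡ l) (esʳ p) = _ , esʳ p , esˡ l

  -- Answers admit no `⇝ˡ` either, so `⇝ᵃ` can be postponed; this is what makes `⇛ᵈ` transitive.
  ⇝ᵃ-⇝ˡ : s ⇝ᵃ t → t ⇝ˡ u → ∃[ r ] (s ⇝ˡ r × r ⇝ᵃ u)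
  ⇝ᵃ-⇝ˡ (root x) (esˡ (esˡ p)) = ⊥-elim (Ans-¬⇝ˡ (Ans-ren x) p)
  ⇝ᵃ-⇝ˡ (root x) (esˡ (esʳ p)) = _ , esʳ (esˡ p) , root x
  ⇝ᵃ-⇝ˡ (root x) (esʳ p)       = _ , esʳ (esʳ p) , root x
  ⇝ᵃ-⇝ˡ (esˡ l) (esˡ p) with _ , p′ , l′ ← ⇝ᵃ-⇝ˡ l p = _ , esˡ p′ , esˡ l′
  ⇝ᵃ-⇝ˡ (esˡ l) (esʳ p) = _ , esʳ p , esˡ l

  ⇝ˡ*-⟶ : s ⇝ˡ* t → Δ ⊢ t ⟶ u → ∃[ r ] (Δ ⊢ s ⟶ r × r ⇝ˡ* u)
  ⇝ˡ*-⟶ ε p = _ , p , ε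
  ⇝ˡ*-⟶ (l ◅ ls) p with _ , q , ls′ ← ⇝ˡ*-⟶ ls p with _ , q′ , ls″ ← ⇝ˡ-⟶ l q = _ , q′ , ls″ ◅◅ ls′

  ⇝ᵃ*-⟶ : s ⇝ᵃ* t → Δ ⊢ t ⟶ u → ∃[ r ] (Δ ⊢ s ⟶ r × r ⇝ᵃ* u)
  ⇝ᵃ*-⟶ ε p = _ , p , ε
  ⇝ᵃ*-⟶ (l ◅ ls) p with _ , q , ls′ ← ⇝ᵃ*-⟶ ls p with _ , q′ , l′ ← ⇝ᵃ-⟶ l q = _ , q′ , l′ ◅ ls′

  ⇝ᵃ*-⇝ˡ : s ⇝ᵃ* t → t ⇝ˡ u → ∃[ r ] (s ⇝ˡ r × r ⇝ᵃ* u)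
  ⇝ᵃ*-⇝ˡ ε p = _ , p , ε
  ⇝ᵃ*-⇝ˡ (l ◅ ls) p with _ , q , ls′ ← ⇝ᵃ*-⇝ˡ ls p with _ , q′ , l′ ← ⇝ᵃ-⇝ˡ l q = _ , q′ , l′ ◅ ls′

  ⇝ᵃ*-⇝ˡ* : s ⇝ᵃ* t → t ⇝ˡ* u → s ⇛ᵈ u
  ⇝ᵃ*-⇝ˡ* as ε = _ , ε , as
  ⇝ᵃ*-⇝ˡ* as (l ◅ ls) with _ , l′ , as′ ← ⇝ᵃ*-⇝ˡ as l with _ , ls′ , as″ ← ⇝ᵃ*-⇝ˡ* as′ ls = _ , l′ ◅ ls′ , as″

  ⇛ᵈ-trans : s ⇛ᵈ t → t ⇛ᵈ u → s ⇛ᵈ u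
  ⇛ᵈ-trans (_ , ls , as) (_ , ls′ , as′) with _ , ls″ , as″ ← ⇝ᵃ*-⇝ˡ* as ls′ = _ , ls ◅◅ ls″ , as″ ◅◅ as′

  ⇛ᵈ-⟶ : s ⇛ᵈ t → Δ ⊢ t ⟶ u → ∃[ r ] (Δ ⊢ s ⟶ r × r ⇛ᵈ u)
  ⇛ᵈ-⟶ (_ , ls , as) p with _ , q , as′ ← ⇝ᵃ*-⟶ as p with _ , q′ , ls′ ← ⇝ˡ*-⟶ ls q = _ , q′ , _ , ls′ , as′

-- Translation of named terms: α-equivalence as equality

open DeBruijn

private variable
  ρ : ℕ → ℕ
  i k : ℕ
  w x y z : Name
  s t t′ u : Term
  a d d′ e r v : Tm
  Γ Γ′ xs ys : List Name
  Δ : List Tm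
  Q Q′ : State


-- Free names are indices beyond Γ: name x is index length Γ + x.
idx : List Name → Name → ℕ
idx []      x = x
idx (y ∷ Γ) x with x ≟ y
... | yes _ = zero
... | no  _ = suc (idx Γ x)

db : List Name → Term → Tm
db Γ (var x)       = ix (idx Γ x)
db Γ (ƛ x t)       = lam (db (x ∷ Γ) t)
db Γ (t · u)       = db Γ t ∙ db Γ u
db Γ (t [ x ∖ u ]) = db (x ∷ Γ) t ⟦ db Γ u ⟧

idx-here : ∀ x → idx (x ∷ Γ) x ≡ zero
idx-here x with x ≟ x
... | yes _   = refl
... | no  x≢x = ⊥-elim (x≢x refl)

idx-there : w ≢ x → idx (x ∷ Γ) w ≡ suc (idx Γ w)
idx-there {w} {x} w≢x with w ≟ x
... | yes w≡x = ⊥-elim (w≢x w≡x)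
... | no  _   = refl

idx-injective : ∀ Γ → idx Γ x ≡ idx Γ y → x ≡ y
idx-injective []      eq = eq
idx-injective {x} {y} (z ∷ Γ) eq with x ≟ z | y ≟ z
... | yes refl | yes refl = refl
... | no _     | no _     = idx-injective Γ (suc-injective eq)

∈-bind⁺ : w ∈ fv t → w ≢ x → w ∈ fv (ƛ x t)
∈-bind⁺ {x = x} = ∈-filter⁺ (λ y → ¬? (y ≟ x))

∈-bind⁻ : ∀ t → w ∈ fv (ƛ x t) → w ∈ fv t × w ≢ x
∈-bind⁻ {x = x} t = ∈-filter⁻ (λ y → ¬? (y ≟ x)) {xs = fv t}

fv⊆names : ∀ t → w ∈ fv t → w ∈ names t
fv⊆names (var x) p = p
fv⊆names (ƛ x t) p = there (fv⊆names t (proj₁ (∈-bind⁻ t p)))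
fv⊆names (t · u) p with ∈-++⁻ (fv t) p
... | inj₁ q = ∈-++⁺ˡ (fv⊆names t q)
... | inj₂ q = ∈-++⁺ʳ (names t) (fv⊆names u q)
fv⊆names (t [ x ∖ u ]) p with ∈-++⁻ (fv (ƛ x t)) p
... | inj₁ q = there (∈-++⁺ˡ (fv⊆names t (proj₁ (∈-bind⁻ t q))))
... | inj₂ q = there (∈-++⁺ʳ (names t) (fv⊆names u q))

bv⊆names : ∀ t → w ∈ bv t → w ∈ names t
bv⊆names (ƛ x t) (here p)  = here p
bv⊆names (ƛ x t) (there p) = there (bv⊆names t p)
bv⊆names (t · u) p with ∈-++⁻ (bv t) p
... | inj₁ q = ∈-++⁺ˡ (bv⊆names t q)
... | inj₂ q = ∈-++⁺ʳ (names t) (bv⊆names u q)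
bv⊆names (t [ x ∖ u ]) (here p)  = here p
bv⊆names (t [ x ∖ u ]) (there p) with ∈-++⁻ (bv t) p
... | inj₁ q = there (∈-++⁺ˡ (bv⊆names t q))
... | inj₂ q = there (∈-++⁺ʳ (names t) (bv⊆names u q))

db-ren : ∀ t → (∀ {w} → w ∈ fv t → idx Γ′ w ≡ ρ (idx Γ w)) → db Γ′ t ≡ ren ρ (db Γ t)

db-ren-bind : ∀ x t → (∀ {w} → w ∈ fv (ƛ x t) → idx Γ′ w ≡ ρ (idx Γ w)) →
              db (x ∷ Γ′) t ≡ ren (ext ρ) (db (x ∷ Γ) t)
db-ren-bind {Γ′} {ρ} {Γ} x t h = db-ren t under
  where
  under : ∀ {w} → w ∈ fv t → idx (x ∷ Γ′) w ≡ ext ρ (idx (x ∷ Γ) w)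
  under {w} p with w ≟ x
  ... | yes _   = refl
  ... | no  w≢x = cong suc (h (∈-bind⁺ {t = t} p w≢x))

db-ren (var x)       h = cong ix (h (here refl))
db-ren (ƛ x t)       h = cong lam (db-ren-bind x t h)
db-ren (t · u)       h = cong₂ _∙_ (db-ren t (h ∘ ∈-++⁺ˡ)) (db-ren u (h ∘ ∈-++⁺ʳ (fv t)))
db-ren (t [ x ∖ u ]) h = cong₂ _⟦_⟧ (db-ren-bind x t (h ∘ ∈-++⁺ˡ)) (db-ren u (h ∘ ∈-++⁺ʳ (fv (ƛ x t))))

db-weaken : ∀ t → x ∉ fv t → db (x ∷ Γ) t ≡ ↑ (db Γ t)
db-weaken t x∉ = db-ren t λ p → idx-there λ { refl → x∉ p }

swapName-injective : ∀ x y → swapName x y w ≡ swapName x y z → w ≡ z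
swapName-injective {w} {z} x y eq with w ≟ x | w ≟ y | z ≟ x | z ≟ y
... | yes refl | _        | yes refl | _        = refl
... | yes refl | _        | no _     | yes refl = sym eq
... | yes refl | _        | no _     | no z≢y   = ⊥-elim (z≢y (sym eq))
... | no _     | yes refl | yes refl | _        = sym eq
... | no _     | yes refl | no _     | yes refl = refl
... | no _     | yes refl | no z≢x   | no _     = ⊥-elim (z≢x (sym eq))
... | no _     | no w≢y   | yes refl | _        = ⊥-elim (w≢y eq)
... | no w≢x   | no _     | no _     | yes refl = ⊥-elim (w≢x eq)
... | no _     | no _     | no _     | no _     = eq

-- Two contexts are needed to go below binders: one is extended by the bound name, the other by its
-- swap, and injectivity of the swap keeps lookups in step.
db-swap : ∀ t → (∀ {w} → w ∈ fv t → idx Γ′ (swapName x y w) ≡ idx Γ w) → db Γ′ (swap x y t) ≡ db Γ t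

db-swap-bind : ∀ z t → (∀ {w} → w ∈ fv (ƛ z t) → idx Γ′ (swapName x y w) ≡ idx Γ w) →
               db (swapName x y z ∷ Γ′) (swap x y t) ≡ db (z ∷ Γ) t
db-swap-bind {Γ′} {x} {y} {Γ} z t h = db-swap t under
  where
  under : ∀ {w} → w ∈ fv t → idx (swapName x y z ∷ Γ′) (swapName x y w) ≡ idx (z ∷ Γ) w
  under {w} p with w ≟ z
  ... | yes refl = idx-here (swapName x y z)
  ... | no  w≢z  = trans (idx-there (w≢z ∘ swapName-injective x y)) (cong suc (h (∈-bind⁺ {t = t} p w≢z)))

db-swap (var x)       h = cong ix (h (here refl))
db-swap (ƛ x t)       h = cong lam (db-swap-bind x t h)
db-swap (t · u)       h = cong₂ _∙_ (db-swap t (h ∘ ∈-++⁺ˡ)) (db-swap u (h ∘ ∈-++⁺ʳ (fv t)))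
db-swap (t [ x ∖ u ]) h = cong₂ _⟦_⟧ (db-swap-bind x t (h ∘ ∈-++⁺ˡ)) (db-swap u (h ∘ ∈-++⁺ʳ (fv (ƛ x t))))

db-fresh : ∀ t → z ∉ x ∷ names t → db (z ∷ Γ) (swap x z t) ≡ db (x ∷ Γ) t
db-fresh {z} {x} {Γ} t z∉ = db-swap t swapped
  where
  swapped : ∀ {w} → w ∈ fv t → idx (z ∷ Γ) (swapName x z w) ≡ idx (x ∷ Γ) w
  swapped {w} p with w ≟ x | w ≟ z
  ... | yes refl | _        = idx-here z
  ... | no _     | yes refl = ⊥-elim (z∉ (there (fv⊆names t p)))
  ... | no _     | no w≢z   = idx-there w≢z

α⇒db : t =α u → ∀ Γ → db Γ t ≡ db Γ u
α⇒db var Γ = refl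
α⇒db (ƛ {z} {t = t} {u = u} z∉t z∉u p) Γ = cong lam
  (trans (sym (db-fresh t z∉t)) (trans (α⇒db p (z ∷ Γ)) (db-fresh u z∉u)))
α⇒db (p · q) Γ = cong₂ _∙_ (α⇒db p Γ) (α⇒db q Γ)
α⇒db (es {z} {t = t} {t′ = t′} z∉t z∉t′ p q) Γ = cong₂ _⟦_⟧
  (trans (sym (db-fresh t z∉t)) (trans (α⇒db p (z ∷ Γ)) (db-fresh t′ z∉t′))) (α⇒db q Γ)

∈⇒≤sum : w ∈ xs → w ≤ sum xs
∈⇒≤sum {xs = x ∷ xs} (here refl) = m≤m+n x (sum xs)
∈⇒≤sum {xs = x ∷ xs} (there p)   = ≤-trans (∈⇒≤sum p) (m≤n+m (sum xs) x)

-- A member of a list of naturals is at most the sum of the list.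
fresh-name : ∀ xs → ∃[ z ] z ∉ xs
fresh-name xs = suc (sum xs) , λ p → 1+n≰n (∈⇒≤sum p)

ix-injective : ix i ≡ ix k → i ≡ k
ix-injective refl = refl

lam-injective : lam d ≡ lam e → d ≡ e
lam-injective refl = refl

∙-injective : ∀ {a b c d} → a ∙ b ≡ c ∙ d → a ≡ c × b ≡ d
∙-injective refl = refl , refl

⟦⟧-injective : ∀ {a b c d} → a ⟦ b ⟧ ≡ c ⟦ d ⟧ → a ≡ c × b ≡ d
⟦⟧-injective refl = refl , refl

-- Recursion is on the common image `d`, because the bodies compared below a binder are swapped
-- terms and not subterms of `t` and `u`.
db⇒α : ∀ d Γ t u → db Γ t ≡ d → db Γ u ≡ d → t =α u
db⇒α (ix i) Γ (var x) (var y) eq eq′ with refl ← idx-injective Γ (ix-injective (trans eq (sym eq′))) = var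
db⇒α (lam d) Γ (ƛ x t) (ƛ y u) eq eq′
  with z , z∉ ← fresh-name ((x ∷ names t) ++ (y ∷ names u))
  = let z∉t = z∉ ∘ ∈-++⁺ˡ ; z∉u = z∉ ∘ ∈-++⁺ʳ (x ∷ names t) in
    ƛ z∉t z∉u (db⇒α d (z ∷ Γ) _ _ (trans (db-fresh t z∉t) (lam-injective eq))
                                  (trans (db-fresh u z∉u) (lam-injective eq′)))
db⇒α (d ∙ e) Γ (t · t′) (u · u′) eq eq′ =
  db⇒α d Γ t u (proj₁ (∙-injective eq)) (proj₁ (∙-injective eq′)) ·
  db⇒α e Γ t′ u′ (proj₂ (∙-injective eq)) (proj₂ (∙-injective eq′))
db⇒α (d ⟦ e ⟧) Γ (t [ x ∖ t′ ]) (u [ y ∖ u′ ]) eq eq′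
  with z , z∉ ← fresh-name ((x ∷ names t) ++ (y ∷ names u))
  = let z∉t = z∉ ∘ ∈-++⁺ˡ ; z∉u = z∉ ∘ ∈-++⁺ʳ (x ∷ names t) in
    es z∉t z∉u (db⇒α d (z ∷ Γ) _ _ (trans (db-fresh t z∉t) (proj₁ (⟦⟧-injective eq)))
                                   (trans (db-fresh u z∉u) (proj₁ (⟦⟧-injective eq′))))
      (db⇒α e Γ t′ u′ (proj₂ (⟦⟧-injective eq)) (proj₂ (⟦⟧-injective eq′)))

≡db⇒α : db [] t ≡ db [] u → t =α u
≡db⇒α eq = db⇒α _ [] _ _ eq refl

α-refl : t =α t
α-refl = ≡db⇒α refl

-- Free indices and the α-invariance of free names

infix 4 _∈ᵈ_

data _∈ᵈ_ : ℕ → Tm → Set where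
  ix   : i ∈ᵈ ix i
  lam  : suc i ∈ᵈ d → i ∈ᵈ lam d
  appˡ : i ∈ᵈ d → i ∈ᵈ d ∙ e
  appʳ : i ∈ᵈ e → i ∈ᵈ d ∙ e
  esˡ  : suc i ∈ᵈ d → i ∈ᵈ d ⟦ e ⟧
  esʳ  : i ∈ᵈ e → i ∈ᵈ d ⟦ e ⟧

fv⇒∈ᵈ : ∀ t → w ∈ fv t → idx Γ w ∈ᵈ db Γ t

fv⇒∈ᵈ-bind : ∀ x t → w ∈ fv (ƛ x t) → suc (idx Γ w) ∈ᵈ db (x ∷ Γ) t
fv⇒∈ᵈ-bind {Γ = Γ} x t p with q , w≢x ← ∈-bind⁻ t p =
  ≡-subst (_∈ᵈ db (x ∷ Γ) t) (idx-there w≢x) (fv⇒∈ᵈ t q)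

fv⇒∈ᵈ (var x) (here refl) = ix
fv⇒∈ᵈ (ƛ x t) p = lam (fv⇒∈ᵈ-bind x t p)
fv⇒∈ᵈ (t · u) p with ∈-++⁻ (fv t) p
... | inj₁ q = appˡ (fv⇒∈ᵈ t q)
... | inj₂ q = appʳ (fv⇒∈ᵈ u q)
fv⇒∈ᵈ (t [ x ∖ u ]) p with ∈-++⁻ (fv (ƛ x t)) p
... | inj₁ q = esˡ (fv⇒∈ᵈ-bind x t q)
... | inj₂ q = esʳ (fv⇒∈ᵈ u q)

∈ᵈ⇒fv : ∀ t → i ∈ᵈ db Γ t → ∃[ w ] (w ∈ fv t × idx Γ w ≡ i)

∈ᵈ⇒fv-bind : ∀ x t → suc i ∈ᵈ db (x ∷ Γ) t → ∃[ w ] (w ∈ fv (ƛ x t) × idx Γ w ≡ i)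
∈ᵈ⇒fv-bind x t p with w , q , eq ← ∈ᵈ⇒fv t p with w ≟ x
... | no w≢x = w , ∈-bind⁺ {t = t} q w≢x , suc-injective eq

∈ᵈ⇒fv (var x) ix = x , here refl , refl
∈ᵈ⇒fv (ƛ x t) (lam p) = ∈ᵈ⇒fv-bind x t p
∈ᵈ⇒fv (t · u) (appˡ p) with w , q , eq ← ∈ᵈ⇒fv t p = w , ∈-++⁺ˡ q , eq
∈ᵈ⇒fv (t · u) (appʳ p) with w , q , eq ← ∈ᵈ⇒fv u p = w , ∈-++⁺ʳ (fv t) q , eq
∈ᵈ⇒fv (t [ x ∖ u ]) (esˡ p) with w , q , eq ← ∈ᵈ⇒fv-bind x t p = w , ∈-++⁺ˡ q , eq
∈ᵈ⇒fv (t [ x ∖ u ]) (esʳ p) with w , q , eq ← ∈ᵈ⇒fv u p = w , ∈-++⁺ʳ (fv (ƛ x t)) q , eq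

-- In the empty context a free name is its own index, so it can be read off the common translation.
fv-α : t =α u → w ∈ fv t → w ∈ fv u
fv-α {t} {u} p q with _ , r , refl ← ∈ᵈ⇒fv {Γ = []} u (≡-subst (_ ∈ᵈ_) (α⇒db p []) (fv⇒∈ᵈ t q)) = r

-- Hygienic representatives

-- The variable convention as a property of raw terms; it provides the side conditions of `mult`,
-- `exp`, `＠l` and `ans`.
record Hygienic (t : Term) : Set where
  constructor _,_
  field
    bv-unique : Unique (bv t)
    bv-fresh  : Disjoint (bv t) (fv t)

range : ℕ → ℕ → List ℕ
range n zero    = []
range n (suc k) = n ∷ range (suc n) k

range-++ : ∀ n k l → range n k ++ range (n + k) l ≡ range n (k + l)
range-++ n zero    l = cong (λ m → range m l) (+-identityʳ n)
range-++ n (suc k) l = cong (n ∷_) (trans (cong (λ m → range (suc n) k ++ range m l) (+-suc n k)) (range-++ (suc n) k l))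

∈-range⇒≤ : ∀ n k → i ∈ range n k → n ≤ i
∈-range⇒≤ n (suc k) (here refl) = ≤-refl
∈-range⇒≤ n (suc k) (there p)   = <⇒≤ (∈-range⇒≤ (suc n) k p)

range-unique : ∀ n k → Unique (range n k)
range-unique n zero    = []
range-unique n (suc k) = All.tabulate (λ p → <⇒≢ (∈-range⇒≤ (suc n) k p)) ∷ range-unique (suc n) k

binders : Tm → ℕ
binders (ix i)     = 0
binders (lam d)    = suc (binders d)
binders (d ∙ e)    = binders d + binders e
binders (d ⟦ e ⟧) = suc (binders d + binders e)

name : List Name → ℕ → Name
name []      i       = i
name (x ∷ Γ) zero    = x
name (x ∷ Γ) (suc i) = name Γ i

-- Binders take consecutive names from `n` on, and the second subterm starts after the `binders d`
-- names used by the first, so all of them are distinct.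
nm : ℕ → List Name → Tm → Term
nm n Γ (ix i)     = var (name Γ i)
nm n Γ (lam d)    = ƛ n (nm (suc n) (n ∷ Γ) d)
nm n Γ (d ∙ e)    = nm n Γ d · nm (n + binders d) Γ e
nm n Γ (d ⟦ e ⟧) = nm (suc n) (n ∷ Γ) d [ n ∖ nm (suc n + binders d) Γ e ]

bv-nm : ∀ n Γ d → bv (nm n Γ d) ≡ range n (binders d)
bv-nm n Γ (ix i)     = refl
bv-nm n Γ (lam d)    = cong (n ∷_) (bv-nm (suc n) (n ∷ Γ) d)
bv-nm n Γ (d ∙ e)    = trans (cong₂ _++_ (bv-nm n Γ d) (bv-nm _ Γ e)) (range-++ n (binders d) (binders e))
bv-nm n Γ (d ⟦ e ⟧) = cong (n ∷_) (trans (cong₂ _++_ (bv-nm (suc n) (n ∷ Γ) d) (bv-nm _ Γ e))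
                                           (range-++ (suc n) (binders d) (binders e)))

-- The first condition says that the name of a free index is not shadowed yet, the second that the
-- binders still to be named, from `n` on, will not shadow it.
Names-below : ℕ → List Name → Tm → Set
Names-below n Γ d = ∀ {i} → i ∈ᵈ d → idx Γ (name Γ i) ≡ i × name Γ i < n

db-nm : ∀ n Γ d → Names-below n Γ d → db Γ (nm n Γ d) ≡ d

db-nm-bind : ∀ n Γ d → (∀ {i} → suc i ∈ᵈ d → idx Γ (name Γ i) ≡ i × name Γ i < n) →
             db (n ∷ Γ) (nm (suc n) (n ∷ Γ) d) ≡ d
db-nm-bind n Γ d h = db-nm (suc n) (n ∷ Γ) d below
  where
  below : Names-below (suc n) (n ∷ Γ) d
  below {zero}  p = idx-here n , n<1+n n
  below {suc i} p = trans (idx-there (<⇒≢ (proj₂ (h p)))) (cong suc (proj₁ (h p))) , <-trans (proj₂ (h p)) (n<1+n n)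

db-nm n Γ (ix i)     h = cong ix (proj₁ (h ix))
db-nm n Γ (lam d)    h = cong lam (db-nm-bind n Γ d (h ∘ lam))
db-nm n Γ (d ∙ e)    h = cong₂ _∙_ (db-nm n Γ d (h ∘ appˡ))
  (db-nm _ Γ e λ p → let eq , lt = h (appʳ p) in eq , <-≤-trans lt (m≤m+n n _))
db-nm n Γ (d ⟦ e ⟧) h = cong₂ _⟦_⟧ (db-nm-bind n Γ d (h ∘ esˡ))
  (db-nm _ Γ e λ p → let eq , lt = h (esʳ p) in eq , <-≤-trans lt (≤-trans (m≤m+n n _) (n≤1+n _)))

free-bound : ∀ d → ∃[ n ] (∀ {i} → i ∈ᵈ d → i < n)
free-bound (ix i) = suc i , λ { ix → ≤-refl }
free-bound (lam d) with n , h ← free-bound d = n , λ { (lam p) → <⇒≤ (h p) }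
free-bound (d ∙ e) with n , h ← free-bound d | m , g ← free-bound e =
  n + m , λ { (appˡ p) → <-≤-trans (h p) (m≤m+n n m) ; (appʳ p) → <-≤-trans (g p) (m≤n+m m n) }
free-bound (d ⟦ e ⟧) with n , h ← free-bound d | m , g ← free-bound e =
  n + m , λ { (esˡ p) → <-≤-trans (<⇒≤ (h p)) (m≤m+n n m) ; (esʳ p) → <-≤-trans (g p) (m≤n+m m n) }

representative : ∀ d xs → ∃[ t ] (db [] t ≡ d × Hygienic t × Disjoint (bv t) xs)
representative d xs = nm b [] d , eq , (unique , λ (p , q) → <⇒≱ (fv<b q) (b≤bv p)) ,
                      λ (p , q) → <⇒≱ (s≤s (∈⇒≤sum q)) (≤-trans (m≤m+n _ _) (b≤bv p))
  where
  -- Above every name in `xs` and every free index of `d`, hence above every free name of the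
  -- representative.
  b = suc (sum xs) + proj₁ (free-bound d)
  below : i ∈ᵈ d → i < b
  below p = <-≤-trans (proj₂ (free-bound d) p) (m≤n+m _ _)
  eq : db [] (nm b [] d) ≡ d
  eq = db-nm b [] d λ p → refl , below p
  unique : Unique (bv (nm b [] d))
  unique = ≡-subst Unique (sym (bv-nm b [] d)) (range-unique b (binders d))
  b≤bv : w ∈ bv (nm b [] d) → b ≤ w
  b≤bv p = ∈-range⇒≤ b (binders d) (≡-subst (_ ∈_) (bv-nm b [] d) p)
  fv<b : w ∈ fv (nm b [] d) → w < b
  fv<b q = below (≡-subst (_ ∈ᵈ_) eq (fv⇒∈ᵈ (nm b [] d) q))

Unique-++⁻ : ∀ xs → Unique (xs ++ ys) → Unique xs × Unique ys × Disjoint xs ys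
Unique-++⁻ []       q = [] , q , λ ()
Unique-++⁻ (x ∷ xs) (p ∷ q) with q₁ , q₂ , dis ← Unique-++⁻ xs q =
  All.++⁻ˡ xs p ∷ q₁ , q₂ , λ { (here refl , r) → All.lookup (All.++⁻ʳ xs p) r refl ; (there l , r) → dis (l , r) }

Hygienic-bind : Unique (x ∷ bv t) → Disjoint (x ∷ bv t) (fv (ƛ x t)) → Hygienic t
Hygienic-bind {x} {t} (x∉ ∷ uq) dis = uq , λ {w} (p , q) →
  dis (there p , ∈-bind⁺ {t = t} q λ { refl → All.lookup x∉ p refl })

Hygienic-· : Hygienic (t · u) → Hygienic t × Hygienic u × Disjoint (bv t) (fv u)
Hygienic-· {t} {u} (uq , dis) with uq₁ , uq₂ , _ ← Unique-++⁻ (bv t) uq =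
  (uq₁ , λ (p , q) → dis (∈-++⁺ˡ p , ∈-++⁺ˡ q)) ,
  (uq₂ , λ (p , q) → dis (∈-++⁺ʳ (bv t) p , ∈-++⁺ʳ (fv t) q)) ,
  λ (p , q) → dis (∈-++⁺ˡ p , ∈-++⁺ʳ (fv t) q)

Hygienic-es : Hygienic (t [ x ∖ u ]) → Hygienic t × Hygienic u × Disjoint (x ∷ bv t) (fv u)
Hygienic-es {t} {x} {u} (x∉ ∷ uq , dis) with uq₁ , uq₂ , _ ← Unique-++⁻ (bv t) uq =
  Hygienic-bind {t = t} (All.++⁻ˡ (bv t) x∉ ∷ uq₁) (λ { (here p , q) → dis (here p , ∈-++⁺ˡ q)
                                              ; (there p , q) → dis (there (∈-++⁺ˡ p) , ∈-++⁺ˡ q) }) ,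
  (uq₂ , λ (p , q) → dis (there (∈-++⁺ʳ (bv t) p) , ∈-++⁺ʳ (fv (ƛ x t)) q)) ,
  λ { (here p , q) → dis (here p , ∈-++⁺ʳ (fv (ƛ x t)) q)
    ; (there p , q) → dis (there (∈-++⁺ˡ p) , ∈-++⁺ʳ (fv (ƛ x t)) q) }

-- Steps of named terms as steps of their translations

scope : WCtx → List Name → List Name
scope □              Γ = Γ
scope (W ·ˡ u)       Γ = scope W Γ
scope (u ·ʳ W)       Γ = scope W Γ
scope (u [ x ∖ W ]ʳ) Γ = scope W Γ
scope (W [ x ∖ u ]ˡ) Γ = scope W (x ∷ Γ)

contents : WCtx → List Name → List Tm → List Tm
contents □              Γ Δ = Δ
contents (W ·ˡ u)       Γ Δ = contents W Γ Δ
contents (u ·ʳ W)       Γ Δ = contents W Γ Δ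
contents (u [ x ∖ W ]ʳ) Γ Δ = contents W Γ Δ
contents (W [ x ∖ u ]ˡ) Γ Δ = contents W (x ∷ Γ) (db Γ u ∷ Δ)

⟶-plug : ∀ W → contents W Γ Δ ⊢ db (scope W Γ) t ⟶ db (scope W Γ) u → Δ ⊢ db Γ (W ⟨ t ⟩) ⟶ db Γ (W ⟨ u ⟩)
⟶-plug □              p = p
⟶-plug (W ·ˡ u)       p = appˡ (⟶-plug W p)
⟶-plug (u ·ʳ W)       p = appʳ (⟶-plug W p)
⟶-plug (u [ x ∖ W ]ʳ) p = esʳ (⟶-plug W p)
⟶-plug (W [ x ∖ u ]ˡ) p = esˡ (⟶-plug W p)

-- As `W` captures neither `x` nor a free name of `u`, crossing one of its binders only shifts the
-- index and lifts the content.
contents-lookup : ∀ W → x ∉ captured W → NoCapture W u → Δ ∋ idx Γ x ↦ db Γ u →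
                  contents W Γ Δ ∋ idx (scope W Γ) x ↦ db (scope W Γ) u
contents-lookup □              x∉ nc p = p
contents-lookup (W ·ˡ _)       x∉ nc p = contents-lookup W x∉ nc p
contents-lookup (_ ·ʳ W)       x∉ nc p = contents-lookup W x∉ nc p
contents-lookup (_ [ _ ∖ W ]ʳ) x∉ nc p = contents-lookup W x∉ nc p
contents-lookup {x} {u} {Δ} {Γ} (W [ y ∖ s ]ˡ) x∉ nc p =
  contents-lookup W (x∉ ∘ there) (λ (q , r) → nc (there q , r)) shifted
  where
  shifted : db Γ s ∷ Δ ∋ idx (y ∷ Γ) x ↦ db (y ∷ Γ) u
  shifted rewrite idx-there {x} {y} {Γ} (x∉ ∘ here) | db-weaken {y} {Γ} u (λ q → nc (here refl , q)) = there p

Mult-db : ∀ S → NoCapture ⌞ S ⌟ u → Mult (db Γ (⌞ S ⌟ ⟨ ƛ x t ⟩)) (db Γ u) (db Γ (⌞ S ⌟ ⟨ t [ x ∖ u ] ⟩))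
Mult-db □ nc = lam
Mult-db {u = u} {Γ} (S [ y ∖ s ]) nc = es (Mult-resp (db-weaken {y} {Γ} u (λ q → nc (here refl , q)))
  (Mult-db S (λ (q , r) → nc (there q , r))))

↦⇒⟶ : t ↦ u → Δ ⊢ db Γ t ⟶ db Γ u
↦⇒⟶ (mult S nc) = mult (Mult-db S nc)
↦⇒⟶ {Δ = Δ} {Γ} (exp {x} {u} W ncx ncu x∉u) =
  esˡ (⟶-plug W (look (contents-lookup {x} {u} W (λ q → ncx (q , here refl)) ncu first)))
  where
  first : db Γ u ∷ Δ ∋ idx (x ∷ Γ) x ↦ db (x ∷ Γ) u
  first rewrite idx-here {Γ} x | db-weaken {x} {Γ} u x∉u = here

weak⇒⟶ : WeakClosure _↦_ t u → Δ ⊢ db Γ t ⟶ db Γ u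
weak⇒⟶ (weak W p) = ⟶-plug W (↦⇒⟶ p)

captured⊆bv : ∀ W → w ∈ captured W → w ∈ bv (W ⟨ t ⟩)
captured⊆bv (W ·ˡ u)       p         = ∈-++⁺ˡ (captured⊆bv W p)
captured⊆bv (u ·ʳ W)       p         = ∈-++⁺ʳ (bv u) (captured⊆bv W p)
captured⊆bv (u [ x ∖ W ]ʳ) p         = there (∈-++⁺ʳ (bv u) (captured⊆bv W p))
captured⊆bv (W [ x ∖ u ]ˡ) (here p)  = here p
captured⊆bv (W [ x ∖ u ]ˡ) (there p) = there (∈-++⁺ˡ (captured⊆bv W p))

module _ {R : Rel Term 0ℓ} where

  weak-·ˡ : WeakClosure R t u → WeakClosure R (t · s) (u · s)
  weak-·ˡ (weak W p) = weak (W ·ˡ _) p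

  weak-·ʳ : WeakClosure R t u → WeakClosure R (s · t) (s · u)
  weak-·ʳ (weak W p) = weak (_ ·ʳ W) p

  weak-esˡ : WeakClosure R t u → WeakClosure R (t [ x ∖ s ]) (u [ x ∖ s ])
  weak-esˡ (weak W p) = weak (W [ _ ∖ _ ]ˡ) p

  weak-esʳ : WeakClosure R t u → WeakClosure R (s [ x ∖ t ]) (s [ x ∖ u ])
  weak-esʳ (weak W p) = weak (_ [ _ ∖ W ]ʳ) p

  weak-plug : ∀ W → WeakClosure R t u → WeakClosure R (W ⟨ t ⟩) (W ⟨ u ⟩)
  weak-plug □              p = p
  weak-plug (W ·ˡ _)       p = weak-·ˡ (weak-plug W p)
  weak-plug (_ ·ʳ W)       p = weak-·ʳ (weak-plug W p)
  weak-plug (_ [ _ ∖ W ]ʳ) p = weak-esʳ (weak-plug W p)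
  weak-plug (W [ _ ∖ _ ]ˡ) p = weak-esˡ (weak-plug W p)

-- Steps of translations as steps of hygienic terms

Mult-reflect : ∀ t → Disjoint (bv t) (fv u) → Mult (db Γ t) (db Γ u) r →
               ∃[ S ] ∃[ x ] ∃[ s ] (t ≡ ⌞ S ⌟ ⟨ ƛ x s ⟩ × NoCapture ⌞ S ⌟ u × db Γ (⌞ S ⌟ ⟨ s [ x ∖ u ] ⟩) ≡ r)
Mult-reflect (ƛ x t) dis lam = □ , x , t , refl , (λ ()) , refl
Mult-reflect {u} {Γ} (t [ y ∖ s ]) dis (es m)
  with S , x , t′ , refl , nc , refl ← Mult-reflect {u} t (λ (p , q) → dis (there (∈-++⁺ˡ p) , q))
         (Mult-resp (sym (db-weaken {y} {Γ} u (λ q → dis (here refl , q)))) m)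
  = S [ y ∖ s ] , x , t′ , refl , (λ { (here refl , q) → dis (here refl , q) ; (there p , q) → nc (p , q) }) , refl

-- A step of db Γ t is either a step of t, or replaces an occurrence of a variable that
-- is bound by the surrounding substitutions Δ and not by t.
data Reflected (Δ : List Tm) (Γ : List Name) (t : Term) (d : Tm) : Set where
  step : WeakClosure _↦_ t t′ → db Γ t′ ≡ d → Reflected Δ Γ t d
  hole : ∀ W → t ≡ W ⟨ var x ⟩ → x ∉ captured W → Δ ∋ idx Γ x ↦ v →
         (∀ u → NoCapture W u → db Γ u ≡ v → db Γ (W ⟨ u ⟩) ≡ d) → Reflected Δ Γ t d

-- A lookup is local in the translation but `exp` is not: the context of the occurrence is
-- accumulated in `hole` until the substitution that binds it is reached, and there it becomes an
-- `exp` step.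
⟶-reflect : ∀ t → Hygienic t → Δ ⊢ db Γ t ⟶ d → Reflected Δ Γ t d
⟶-reflect (var x) hyg (look p) = hole □ refl (λ ()) p (λ _ _ eq → eq)
⟶-reflect (t · u) hyg (mult m)
  with S , x , s , refl , nc , eq ← Mult-reflect {u} t (proj₂ (proj₂ (Hygienic-· hyg))) m
  = step (weak □ (mult S nc)) eq
⟶-reflect (t · u) hyg (appˡ p) with ⟶-reflect t (proj₁ (Hygienic-· hyg)) p
... | step q eq            = step (weak-·ˡ q) (cong (_∙ _) eq)
... | hole W refl x∉ l h   = hole (W ·ˡ u) refl x∉ l λ s nc eq → cong (_∙ _) (h s nc eq)
⟶-reflect (t · u) hyg (appʳ p) with ⟶-reflect u (proj₁ (proj₂ (Hygienic-· hyg))) p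
... | step q eq            = step (weak-·ʳ q) (cong (_ ∙_) eq)
... | hole W refl x∉ l h   = hole (t ·ʳ W) refl x∉ l λ s nc eq → cong (_ ∙_) (h s nc eq)
⟶-reflect (t [ x ∖ u ]) hyg (esʳ p) with ⟶-reflect u (proj₁ (proj₂ (Hygienic-es hyg))) p
... | step q eq            = step (weak-esʳ q) (cong (_ ⟦_⟧) eq)
... | hole W refl x∉ l h   = hole (t [ x ∖ W ]ʳ) refl x∉ l λ s nc eq → cong (_ ⟦_⟧) (h s nc eq)
⟶-reflect (t [ x ∖ u ]) hyg (esˡ p) with ⟶-reflect t (proj₁ (Hygienic-es hyg)) p
... | step q eq = step (weak-esˡ q) (cong (_⟦ _ ⟧) eq)
⟶-reflect {Γ = Γ} (t [ x ∖ u ]) hyg (esˡ p) | hole {x = y} W refl y∉ l h with y ≟ x | l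
... | yes refl | here =
  let dis = proj₂ (proj₂ (Hygienic-es hyg))
      x∉u = λ q → dis (here refl , q)
      ncu = λ {z} ((q , r) : z ∈ captured W × z ∈ fv u) → dis (there (captured⊆bv W q) , r)
  in step (weak □ (exp W (λ { (q , here refl) → y∉ q }) ncu x∉u)) (cong (_⟦ _ ⟧) (h u ncu (db-weaken {x} {Γ} u x∉u)))
... | no y≢x | there l′ = hole (W [ x ∖ u ]ˡ) refl (λ { (here eq) → y≢x eq ; (there q) → y∉ q }) l′
  λ s nc eq → cong (_⟦ _ ⟧) (h s (λ (q , r) → nc (there q , r))
                                 (trans (db-weaken {x} {Γ} s (λ q → nc (here refl , q))) (cong ↑ eq)))

⇝ˡ-reflect : ∀ t → Hygienic t → db Γ t ⇝ˡ d → ∃[ t′ ] (WeakClosure _↦＠l_ t t′ × db Γ t′ ≡ d)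
⇝ˡ-reflect {Γ} (t [ x ∖ u ] · s) hyg root =
  let x∉s = λ q → proj₂ (proj₂ (Hygienic-· hyg)) (here refl , q) in
  _ , weak □ (＠l x∉s) , cong (λ z → (_ ∙ z) ⟦ _ ⟧) (db-weaken {x} {Γ} s x∉s)
⇝ˡ-reflect (t · u) hyg (appˡ p)
  with _ , q , refl ← ⇝ˡ-reflect t (proj₁ (Hygienic-· hyg)) p = _ , weak-·ˡ q , refl
⇝ˡ-reflect (t · u) hyg (appʳ p)
  with _ , q , refl ← ⇝ˡ-reflect u (proj₁ (proj₂ (Hygienic-· hyg))) p = _ , weak-·ʳ q , refl
⇝ˡ-reflect (t [ x ∖ u ]) hyg (esˡ p)
  with _ , q , refl ← ⇝ˡ-reflect t (proj₁ (Hygienic-es hyg)) p = _ , weak-esˡ q , refl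
⇝ˡ-reflect (t [ x ∖ u ]) hyg (esʳ p)
  with _ , q , refl ← ⇝ˡ-reflect u (proj₁ (proj₂ (Hygienic-es hyg))) p = _ , weak-esʳ q , refl

Answer⇒Ans : Answer t → Ans (db Γ t)
Answer⇒Ans val      = lam
Answer⇒Ans (es p q) = es (Answer⇒Ans p) (Answer⇒Ans q)

Ans⇒Answer : ∀ t → Ans (db Γ t) → Answer t
Ans⇒Answer (ƛ x t)       lam      = val
Ans⇒Answer (t [ x ∖ u ]) (es p q) = es (Ans⇒Answer t p) (Ans⇒Answer u q)

db-extrude : ∀ a → y ∉ fv a → db (x ∷ y ∷ Γ) a ≡ ren (ext suc) (db (x ∷ Γ) a)
db-extrude {y} {x} {Γ} a y∉ = db-ren-bind x a λ p → idx-there λ { refl → y∉ (proj₁ (∈-bind⁻ a p)) }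

Hygienic-extrude : ∀ a t → Hygienic (a [ x ∖ t ]) → y ∈ bv t → y ∉ fv a
Hygienic-extrude a t (x∉ ∷ _ , dis) y∈ q =
  dis (there (∈-++⁺ʳ (bv a) y∈) , ∈-++⁺ˡ (∈-bind⁺ {t = a} q λ { refl → All.lookup x∉ (∈-++⁺ʳ (bv a) y∈) refl }))

⇝ᵃ-reflect : ∀ t → Hygienic t → db Γ t ⇝ᵃ d → ∃[ t′ ] (SubstClosure _↦ans_ t t′ × db Γ t′ ≡ d)
⇝ᵃ-reflect (a [ x ∖ t [ y ∖ u ] ]) hyg (root p) =
  let y∉a = Hygienic-extrude a (t [ y ∖ u ]) hyg (here refl) in
  _ , subst □ (ans (Ans⇒Answer a p) y∉a) , cong (λ z → z ⟦ _ ⟧ ⟦ _ ⟧) (db-extrude a y∉a)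
⇝ᵃ-reflect (t [ x ∖ u ]) hyg (esˡ p)
  with _ , subst S q , refl ← ⇝ᵃ-reflect t (proj₁ (Hygienic-es hyg)) p = _ , subst (S [ x ∖ u ]) q , refl

Reflects : Rel Term 0ℓ → Rel Tm 0ℓ → Set
Reflects R R′ = ∀ {t d} → Hygienic t → R′ (db [] t) d → ∃[ u ] (R t u × db [] u ≡ d)

-- Steps need not preserve hygiene, as `exp` duplicates bound names, so a new hygienic
-- representative is taken before each of them.
*-reflect : ∀ {R R′} → Reflects R R′ → Star R′ d e → db [] t ≡ d → db [] u ≡ e → (R */α) t u
*-reflect h ε eq eq′ = _ , ≡db⇒α (trans eq (sym eq′)) , ε
*-reflect {d = d} h (p ◅ ps) eq eq′
  with t₀ , refl , hyg , _ ← representative d []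
  with t₁ , q , refl ← h hyg p
  with t₂ , α , qs ← *-reflect h ps refl eq′
  = _ , α-refl , (t₀ , ≡db⇒α eq , t₁ , q , α) ◅ qs

⟶*-reflect : [] ⊢ db [] t ⟶* db [] u → t →w¬gcv* u
⟶*-reflect ps = *-reflect reflects ps refl refl
  where
  reflects : Reflects (WeakClosure _↦_) ([] ⊢_⟶_)
  -- The `hole` case would need an entry in the empty environment.
  reflects hyg p with step q eq ← ⟶-reflect _ hyg p = _ , q , eq

⇛ᵈ-reflect : db [] t ⇛ᵈ db [] u → t ⇛ u
⇛ᵈ-reflect (e , ls , as) with s , refl , _ ← representative e [] =
  s , *-reflect (⇝ˡ-reflect _) ls refl refl , *-reflect (⇝ᵃ-reflect _) as refl refl

→w¬gcv*⇒⟶* : t →w¬gcv* u → [] ⊢ db [] t ⟶* db [] u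
→w¬gcv*⇒⟶* (t′ , α , ps) = ≡-subst ([] ⊢_⟶* _) (sym (α⇒db α [])) (steps ps)
  where
  steps : Star (WeakClosure _↦_ /α) t u → [] ⊢ db [] t ⟶* db [] u
  steps ε = ε
  steps ((_ , α , _ , p , β) ◅ ps) rewrite α⇒db α [] = ≡-subst ([] ⊢ _ ⟶_) (α⇒db β []) (weak⇒⟶ p) ◅ steps ps

-- Plugging, read-backs and the names they bind

plug-∘ : ∀ W V → (W ⟪ V ⟫) ⟨ t ⟩ ≡ W ⟨ V ⟨ t ⟩ ⟩
plug-∘ □              V = refl
plug-∘ (W ·ˡ u)       V = cong (_· u) (plug-∘ W V)
plug-∘ (u ·ʳ W)       V = cong (u ·_) (plug-∘ W V)
plug-∘ (u [ x ∖ W ]ʳ) V = cong (u [ x ∖_]) (plug-∘ W V)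
plug-∘ (W [ x ∖ u ]ˡ) V = cong (_[ x ∖ u ]) (plug-∘ W V)

db-plug : ∀ W → (∀ Γ → db Γ t ≡ db Γ u) → ∀ Γ → db Γ (W ⟨ t ⟩) ≡ db Γ (W ⟨ u ⟩)
db-plug □              h Γ = h Γ
db-plug (W ·ˡ u)       h Γ = cong (_∙ _) (db-plug W h Γ)
db-plug (u ·ʳ W)       h Γ = cong (_ ∙_) (db-plug W h Γ)
db-plug (u [ x ∖ W ]ʳ) h Γ = cong (_ ⟦_⟧) (db-plug W h Γ)
db-plug (W [ x ∖ u ]ˡ) h Γ = cong (_⟦ _ ⟧) (db-plug W h (x ∷ Γ))

⇝ˡ*-plug : ∀ W → (∀ Γ → db Γ t ⇝ˡ* db Γ u) → ∀ Γ → db Γ (W ⟨ t ⟩) ⇝ˡ* db Γ (W ⟨ u ⟩)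
⇝ˡ*-plug □              h Γ = h Γ
⇝ˡ*-plug (W ·ˡ u)       h Γ = gmap (_∙ _) appˡ (⇝ˡ*-plug W h Γ)
⇝ˡ*-plug (u ·ʳ W)       h Γ = gmap (_ ∙_) appʳ (⇝ˡ*-plug W h Γ)
⇝ˡ*-plug (u [ x ∖ W ]ʳ) h Γ = gmap (_ ⟦_⟧) esʳ (⇝ˡ*-plug W h Γ)
⇝ˡ*-plug (W [ x ∖ u ]ˡ) h Γ = gmap (_⟦ _ ⟧) esˡ (⇝ˡ*-plug W h (x ∷ Γ))

-- The read-back of an environment is a substitution context, and `⇝ᵃ` is closed under these.
⇝ᵃ*-readᵉ : ∀ E → (∀ Γ → db Γ t ⇝ᵃ* db Γ u) → ∀ Γ → db Γ (readᵉ E ⟨ t ⟩) ⇝ᵃ* db Γ (readᵉ E ⟨ u ⟩)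
⇝ᵃ*-readᵉ [] h Γ = h Γ
⇝ᵃ*-readᵉ {t} {u} ((x , s) ∷ E) h Γ
  rewrite plug-∘ {t} (readᵉ E) (□ [ x ∖ s ]ˡ) | plug-∘ {u} (readᵉ E) (□ [ x ∖ s ]ˡ)
  = ⇝ᵃ*-readᵉ E (λ Γ → gmap (_⟦ _ ⟧) esˡ (h (x ∷ Γ))) Γ

-- The invariant of the read-back along a run of the machine.
record Proper (t : Term) : Set where
  constructor _,_
  field
    bv-unique : Unique (bv t)
    closed    : ∀ {w} → w ∉ fv t

Proper⇒Hygienic : Proper t → Hygienic t
Proper⇒Hygienic (uq , closed) = uq , λ (_ , q) → closed q

infix 4 _≽_

-- Distinctness of bound names survives permutation, and closedness survives the loss of free names,
-- so `Proper` passes from `t` to `u`.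
record _≽_ (t u : Term) : Set where
  constructor _,_
  field
    bv-↭ : bv t ↭ bv u
    fv-⊇ : ∀ {w} → w ∈ fv u → w ∈ fv t

Proper-≽ : t ≽ u → Proper t → Proper u
Proper-≽ (perm , sub) (uq , closed) = Unique-resp-↭ (setoid _) (↭⇒↭ₛ perm) uq , closed ∘ sub

≽-refl : t ≽ t
≽-refl = ↭-refl , id

≽-trans : t ≽ s → s ≽ u → t ≽ u
≽-trans (p , f) (q , g) = ↭-trans p q , (f ∘ g)

∈-·⁻ : ∀ t u → w ∈ fv (t · u) → w ∈ fv t ⊎ w ∈ fv u
∈-·⁻ t _ = ∈-++⁻ (fv t)

∈-·⁺ˡ : ∀ t u → w ∈ fv t → w ∈ fv (t · u)
∈-·⁺ˡ t u = ∈-++⁺ˡ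

∈-·⁺ʳ : ∀ t u → w ∈ fv u → w ∈ fv (t · u)
∈-·⁺ʳ t u = ∈-++⁺ʳ (fv t)

∈-es⁺ˡ : ∀ t u → w ∈ fv t → w ≢ x → w ∈ fv (t [ x ∖ u ])
∈-es⁺ˡ t _ p w≢x = ∈-++⁺ˡ (∈-bind⁺ {t = t} p w≢x)

∈-es⁺ʳ : ∀ t u → w ∈ fv u → w ∈ fv (t [ x ∖ u ])
∈-es⁺ʳ {x = x} t _ = ∈-++⁺ʳ (fv (ƛ x t))

∈-es⁻ : ∀ t u → w ∈ fv (t [ x ∖ u ]) → (w ∈ fv t × w ≢ x) ⊎ w ∈ fv u
∈-es⁻ {x = x} t _ p = Sum.map₁ (∈-bind⁻ t) (∈-++⁻ (fv (ƛ x t)) p)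

module _ {P : Name → Set} (t u : Term) (h : ∀ {w} → w ∈ fv t → w ∈ fv u ⊎ P w) where

  -- `P` holds of the names that `t` may bring in beyond those of `u`: none for `fv-plug-⊆`, the
  -- free names of the copy for a lookup.
  fv-plug : ∀ W {w} → w ∈ fv (W ⟨ t ⟩) → w ∈ fv (W ⟨ u ⟩) ⊎ P w
  fv-plug □ p = h p
  fv-plug (W ·ˡ s) p with ∈-·⁻ (W ⟨ t ⟩) s p
  ... | inj₁ q = Sum.map₁ (∈-·⁺ˡ (W ⟨ u ⟩) s) (fv-plug W q)
  ... | inj₂ q = inj₁ (∈-·⁺ʳ (W ⟨ u ⟩) s q)
  fv-plug (s ·ʳ W) p with ∈-·⁻ s (W ⟨ t ⟩) p
  ... | inj₁ q = inj₁ (∈-·⁺ˡ s (W ⟨ u ⟩) q)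
  ... | inj₂ q = Sum.map₁ (∈-·⁺ʳ s (W ⟨ u ⟩)) (fv-plug W q)
  fv-plug (s [ x ∖ W ]ʳ) p with ∈-es⁻ s (W ⟨ t ⟩) p
  ... | inj₁ (q , w≢x) = inj₁ (∈-es⁺ˡ s (W ⟨ u ⟩) q w≢x)
  ... | inj₂ q         = Sum.map₁ (∈-es⁺ʳ s (W ⟨ u ⟩)) (fv-plug W q)
  fv-plug (W [ x ∖ s ]ˡ) p with ∈-es⁻ (W ⟨ t ⟩) s p
  ... | inj₁ (q , w≢x) = Sum.map₁ (λ r → ∈-es⁺ˡ (W ⟨ u ⟩) s r w≢x) (fv-plug W q)
  ... | inj₂ q         = inj₁ (∈-es⁺ʳ (W ⟨ u ⟩) s q)

fv-plug-⊆ : ∀ t u → (∀ {w} → w ∈ fv t → w ∈ fv u) → ∀ W {w} → w ∈ fv (W ⟨ t ⟩) → w ∈ fv (W ⟨ u ⟩)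
fv-plug-⊆ t u h W p = Sum.[ id , (λ ()) ] (fv-plug {λ _ → ⊥} t u (inj₁ ∘ h) W p)

bv-plug : ∀ W → bv t ↭ bv u → bv (W ⟨ t ⟩) ↭ bv (W ⟨ u ⟩)
bv-plug □              p = p
bv-plug (W ·ˡ s)       p = ++⁺ʳ (bv s) (bv-plug W p)
bv-plug (s ·ʳ W)       p = ++⁺ˡ (bv s) (bv-plug W p)
bv-plug (s [ x ∖ W ]ʳ) p = prep x (++⁺ˡ (bv s) (bv-plug W p))
bv-plug (W [ x ∖ s ]ˡ) p = prep x (++⁺ʳ (bv s) (bv-plug W p))

≽-plug : ∀ W → t ≽ u → W ⟨ t ⟩ ≽ W ⟨ u ⟩
≽-plug {t} {u} W (p , f) = bv-plug W p , fv-plug-⊆ u t f W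

Hygienic-plug : ∀ W → Hygienic (W ⟨ t ⟩) → Hygienic t
Hygienic-plug □ h = h
Hygienic-plug (W ·ˡ s) h = Hygienic-plug W (proj₁ (Hygienic-· h))
Hygienic-plug (s ·ʳ W) h = Hygienic-plug W (proj₁ (proj₂ (Hygienic-· h)))
Hygienic-plug (s [ x ∖ W ]ʳ) h = Hygienic-plug W (proj₁ (proj₂ (Hygienic-es h)))
Hygienic-plug (W [ x ∖ s ]ˡ) h = Hygienic-plug W (proj₁ (Hygienic-es h))

readᶜ-Answer : ∀ C {v} → Answer (readᶜ C ⟨ ⌜ v ⌝ ⟩)
readᶜ-Answer ε             = val
readᶜ-Answer (C ∷⟨ v , x ⟩) = es (readᶜ-Answer C) val

-- The β transition

＠l-≽ : ∀ t → t [ x ∖ u ] · s ≽ (t · s) [ x ∖ u ]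
＠l-≽ {x} {u} {s} t = prep x perm , sub
  where
  perm : (bv t ++ bv u) ++ bv s ↭ (bv t ++ bv s) ++ bv u
  perm = ↭-trans (↭-reflexive (++-assoc (bv t) _ _))
         (↭-trans (++⁺ˡ (bv t) (++-comm (bv u) (bv s))) (↭-reflexive (sym (++-assoc (bv t) _ _))))
  sub : w ∈ fv ((t · s) [ x ∖ u ]) → w ∈ fv (t [ x ∖ u ] · s)
  sub p with ∈-es⁻ (t · s) u p
  ... | inj₂ q = ∈-·⁺ˡ (t [ x ∖ u ]) s (∈-es⁺ʳ t u q)
  ... | inj₁ (q , w≢x) with ∈-·⁻ t s q
  ...   | inj₁ r = ∈-·⁺ˡ (t [ x ∖ u ]) s (∈-es⁺ˡ t u r w≢x)
  ...   | inj₂ r = ∈-·⁺ʳ (t [ x ∖ u ]) s r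

ans-≽ : ∀ a t → a [ y ∖ t [ x ∖ u ] ] ≽ a [ y ∖ t ] [ x ∖ u ]
ans-≽ {y} {x} {u} a t = perm , sub
  where
  perm : y ∷ bv a ++ x ∷ bv t ++ bv u ↭ x ∷ (y ∷ bv a ++ bv t) ++ bv u
  perm = ↭-trans (shift x (y ∷ bv a) (bv t ++ bv u)) (prep x (↭-reflexive (sym (++-assoc (y ∷ bv a) _ _))))
  sub : w ∈ fv (a [ y ∖ t ] [ x ∖ u ]) → w ∈ fv (a [ y ∖ t [ x ∖ u ] ])
  sub p with ∈-es⁻ (a [ y ∖ t ]) u p
  ... | inj₂ q = ∈-es⁺ʳ a (t [ x ∖ u ]) (∈-es⁺ʳ t u q)
  ... | inj₁ (q , w≢x) with ∈-es⁻ a t q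
  ...   | inj₁ (r , w≢y) = ∈-es⁺ˡ a (t [ x ∖ u ]) r w≢y
  ...   | inj₂ r         = ∈-es⁺ʳ a (t [ x ∖ u ]) (∈-es⁺ˡ t u r w≢x)

stack-≽ : ∀ π t → readˢ π ⟨ t [ x ∖ u ] ⟩ ≽ readˢ π ⟨ t ⟩ [ x ∖ u ]
stack-≽ [] t = ≽-refl
stack-≽ {x} {u} (s ∷ π) t
  rewrite plug-∘ {t [ x ∖ u ]} (readˢ π) (□ ·ˡ s) | plug-∘ {t} (readˢ π) (□ ·ˡ s)
  = ≽-trans (≽-plug (readˢ π) (＠l-≽ t)) (stack-≽ π (t · s))

answer-≽ : ∀ C t → readᶜ C ⟨ t [ x ∖ u ] ⟩ ≽ readᶜ C ⟨ t ⟩ [ x ∖ u ]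
answer-≽ ε              t = ≽-refl
answer-≽ (C ∷⟨ v , y ⟩) t = ans-≽ (readᶜ C ⟨ ⌜ v ⌝ ⟩) t

-- One extrusion per stack entry. `t′` stands for the redex in the hole before the step: it binds
-- `x`, so hygiene of that earlier term keeps `x` out of the stack.
stack-⇝ˡ* : ∀ π t → Hygienic (readˢ π ⟨ t′ ⟩) → x ∈ bv t′ →
            ∀ Γ → db Γ (readˢ π ⟨ t [ x ∖ u ] ⟩) ⇝ˡ* db Γ (readˢ π ⟨ t ⟩ [ x ∖ u ])
stack-⇝ˡ* [] t h x∈ Γ = ε
stack-⇝ˡ* {t′} {x} {u} (s ∷ π) t h x∈ Γ
  rewrite plug-∘ {t′} (readˢ π) (□ ·ˡ s) | plug-∘ {t [ x ∖ u ]} (readˢ π) (□ ·ˡ s) | plug-∘ {t} (readˢ π) (□ ·ˡ s)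
  = ⇝ˡ*-plug (readˢ π) (λ Γ → extrude Γ ◅ ε) Γ ◅◅ stack-⇝ˡ* {t′ · s} π (t · s) h (∈-++⁺ˡ x∈) Γ
  where
  x∉s : x ∉ fv s
  x∉s q = proj₂ (proj₂ (Hygienic-· (Hygienic-plug (readˢ π) h))) (x∈ , q)
  extrude : ∀ Γ → db Γ (t [ x ∖ u ] · s) ⇝ˡ db Γ ((t · s) [ x ∖ u ])
  extrude Γ rewrite db-weaken {x} {Γ} s x∉s = root

-- The hole of a nonempty partial answer is the content of its outermost substitution, with an
-- answer on the left, so one extrusion suffices.
answer-⇝ᵃ* : ∀ C t → Hygienic (readᶜ C ⟨ t′ ⟩) → x ∈ bv t′ →
             ∀ Γ → db Γ (readᶜ C ⟨ t [ x ∖ u ] ⟩) ⇝ᵃ* db Γ (readᶜ C ⟨ t ⟩ [ x ∖ u ])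
answer-⇝ᵃ* ε t h x∈ Γ = ε
answer-⇝ᵃ* {t′} {x} (C ∷⟨ v , y ⟩) t h x∈ Γ
  rewrite db-extrude {x} {y} {Γ} (readᶜ C ⟨ ⌜ v ⌝ ⟩) (Hygienic-extrude (readᶜ C ⟨ ⌜ v ⌝ ⟩) t′ h x∈)
  = root (Answer⇒Ans (readᶜ-Answer C)) ◅ ε

∈bv-plug : ∀ W → w ∈ bv t → w ∈ bv (W ⟨ t ⟩)
∈bv-plug □              p = p
∈bv-plug (W ·ˡ s)       p = ∈-++⁺ˡ (∈bv-plug W p)
∈bv-plug (s ·ʳ W)       p = ∈-++⁺ʳ (bv s) (∈bv-plug W p)
∈bv-plug (s [ x ∖ W ]ʳ) p = there (∈-++⁺ʳ (bv s) (∈bv-plug W p))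
∈bv-plug (W [ x ∖ s ]ˡ) p = there (∈-++⁺ˡ (∈bv-plug W p))

record Simulates (t u : Term) : Set where
  constructor simulates
  field
    {reduct}   : Tm
    reduces    : [] ⊢ db [] t ⟶ reduct
    structural : reduct ⇛ᵈ db [] u
    proper     : Proper u

beta-simulates : ∀ C π E → Proper (readback ⟨ C , ƛ x t , u ∷ π , E ⟩ˢ) →
                 Simulates (readback ⟨ C , ƛ x t , u ∷ π , E ⟩ˢ) (readback ⟨ C , t , π , (x , u) ∷ E ⟩ˢ)
beta-simulates {x} {t} {u} C π E pr
  rewrite plug-∘ {ƛ x t} (readˢ π) (□ ·ˡ u) | plug-∘ {readᶜ C ⟨ readˢ π ⟨ t ⟩ ⟩} (readᵉ E) (□ [ x ∖ u ]ˡ)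
  = simulates
    (weak⇒⟶ (weak-plug (readᵉ E) (weak-plug (readᶜ C) (weak-plug (readˢ π) (weak □ (mult □ λ ()))))))
    (_ , ⇝ˡ*-plug (readᵉ E) (⇝ˡ*-plug (readᶜ C) (stack-⇝ˡ* π t hygˢ (here refl))) []
       , ⇝ᵃ*-readᵉ E (answer-⇝ᵃ* C (readˢ π ⟨ t ⟩) hygᶜ (∈bv-plug (readˢ π) (here refl))) [])
    -- The redex `ƛ x t · u` and its contractum `t [ x ∖ u ]` have by definition the same bound
    -- names and the same free names.
    (Proper-≽ (≽-trans (≽-plug (readᵉ E) (≽-plug (readᶜ C) (≽-plug (readˢ π) (↭-refl , id))))
              (≽-trans (≽-plug (readᵉ E) (≽-plug (readᶜ C) (stack-≽ π t)))
                       (≽-plug (readᵉ E) (answer-≽ C (readˢ π ⟨ t ⟩))))) pr)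
  where
  hygᶜ : Hygienic (readᶜ C ⟨ readˢ π ⟨ ƛ x t · u ⟩ ⟩)
  hygᶜ = Hygienic-plug (readᵉ E) (Proper⇒Hygienic pr)
  hygˢ : Hygienic (readˢ π ⟨ ƛ x t · u ⟩)
  hygˢ = Hygienic-plug (readᶜ C) hygᶜ

-- The lookup transition

bv-plug-var : ∀ W → bv (W ⟨ t ⟩) ↭ bv t ++ bv (W ⟨ var x ⟩)
bv-plug-var {t} □ = ↭-reflexive (sym (++-identityʳ (bv t)))
bv-plug-var {t} (W ·ˡ s) = ↭-trans (++⁺ʳ (bv s) (bv-plug-var W)) (↭-reflexive (++-assoc (bv t) _ _))
bv-plug-var {t} (s ·ʳ W) = ↭-trans (++⁺ˡ (bv s) (bv-plug-var W)) (shifts (bv s) (bv t))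
bv-plug-var {t} (s [ y ∖ W ]ʳ) =
  ↭-trans (prep y (↭-trans (++⁺ˡ (bv s) (bv-plug-var W)) (shifts (bv s) (bv t)))) (↭-sym (shift y (bv t) _))
bv-plug-var {t} (W [ y ∖ s ]ˡ) =
  ↭-trans (prep y (↭-trans (++⁺ʳ (bv s) (bv-plug-var W)) (↭-reflexive (++-assoc (bv t) _ _)))) (↭-sym (shift y (bv t) _))

bv-readˢ : ∀ π → w ∈ bv (readˢ π ⟨ t ⟩) → w ∈ bv t ⊎ w ∈ namesˢ π
bv-readˢ [] p = inj₁ p
bv-readˢ {t = t} (s ∷ π) p rewrite plug-∘ {t} (readˢ π) (□ ·ˡ s) with bv-readˢ π p
... | inj₂ q = inj₂ (∈-++⁺ʳ (names s) q)
... | inj₁ q with ∈-++⁻ (bv t) q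
...   | inj₁ r = inj₁ r
...   | inj₂ r = inj₂ (∈-++⁺ˡ (bv⊆names s r))

bv-readᵉ : ∀ E → w ∈ bv (readᵉ E ⟨ t ⟩) → w ∈ bv t ⊎ w ∈ namesᵉ E
bv-readᵉ [] p = inj₁ p
bv-readᵉ {t = t} ((x , s) ∷ E) p rewrite plug-∘ {t} (readᵉ E) (□ [ x ∖ s ]ˡ) with bv-readᵉ E p
... | inj₂ q = inj₂ (there (∈-++⁺ʳ (names s) q))
... | inj₁ (here refl) = inj₂ (here refl)
... | inj₁ (there q) with ∈-++⁻ (bv t) q
...   | inj₁ r = inj₁ r
...   | inj₂ r = inj₂ (there (∈-++⁺ˡ (bv⊆names s r)))

bv-readᶜ : ∀ C → w ∈ bv (readᶜ C ⟨ t ⟩) → w ∈ bv t ⊎ w ∈ namesᶜ C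
bv-readᶜ ε p = inj₁ p
bv-readᶜ (C ∷⟨ v , x ⟩) (here refl) = inj₂ (∈-++⁺ʳ (namesᶜ C) (∈-++⁺ʳ (names ⌜ v ⌝) (here refl)))
bv-readᶜ (C ∷⟨ v , x ⟩) (there p) with ∈-++⁻ (bv (readᶜ C ⟨ ⌜ v ⌝ ⟩)) p
... | inj₂ q = inj₁ q
... | inj₁ q with bv-readᶜ C q
...   | inj₁ r = inj₂ (∈-++⁺ʳ (namesᶜ C) (∈-++⁺ˡ (bv⊆names ⌜ v ⌝ r)))
...   | inj₂ r = inj₂ (∈-++⁺ˡ r)

-- A variable code binds nothing, so a copy fresh for the names of `C`, `π` and `E` is fresh for all
-- binders of the read-back.
bv-readback-var : ∀ C π E → w ∈ bv (readback ⟨ C , var x , π , E ⟩ˢ) → w ∈ namesᶜ C ++ namesˢ π ++ namesᵉ E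
bv-readback-var C π E p with bv-readᵉ E p
... | inj₂ q = ∈-++⁺ʳ (namesᶜ C) (∈-++⁺ʳ (namesˢ π) q)
... | inj₁ q with bv-readᶜ C q
...   | inj₂ r = ∈-++⁺ˡ r
...   | inj₁ r with bv-readˢ π r
...     | inj₂ s = ∈-++⁺ʳ (namesᶜ C) (∈-++⁺ˡ s)

readᵉ-++ : ∀ E₁ E₂ → readᵉ (E₁ ++ (x , u) ∷ E₂) ⟨ t ⟩ ≡ readᵉ E₂ ⟨ readᵉ E₁ ⟨ t ⟩ [ x ∖ u ] ⟩
readᵉ-++ [] E₂ = plug-∘ (readᵉ E₂) _
readᵉ-++ ((y , s) ∷ E₁) E₂ = trans (plug-∘ (readᵉ (E₁ ++ _ ∷ E₂)) _)
  (trans (readᵉ-++ E₁ E₂) (cong (λ z → readᵉ E₂ ⟨ z [ _ ∖ _ ] ⟩) (sym (plug-∘ (readᵉ E₁) _))))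

-- Brings the read-back into the shape of the `exp` rule: `E₁`, being nearer to the head, lies
-- inside the entry looked up, and `E₂` outside.
readback-look : ∀ C π E₁ E₂ t → readback ⟨ C , t , π , E₁ ++ (x , u) ∷ E₂ ⟩ˢ
                                ≡ readᵉ E₂ ⟨ (readᵉ E₁ ⟪ readᶜ C ⟪ readˢ π ⟫ ⟫) ⟨ t ⟩ [ x ∖ u ] ⟩
readback-look C π E₁ E₂ t = trans (readᵉ-++ E₁ E₂)
  (cong (λ z → readᵉ E₂ ⟨ z [ _ ∖ _ ] ⟩) (sym (trans (plug-∘ (readᵉ E₁) _) (cong (readᵉ E₁ ⟨_⟩) (plug-∘ (readᶜ C) _)))))

exp-simulates : ∀ V W → Proper (V ⟨ W ⟨ var x ⟩ [ x ∖ t ] ⟩) → t′ =α t → Unique (bv t′) →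
                Disjoint (bv t′) (bv (V ⟨ W ⟨ var x ⟩ [ x ∖ t ] ⟩)) →
                Simulates (V ⟨ W ⟨ var x ⟩ [ x ∖ t ] ⟩) (V ⟨ W ⟨ t′ ⟩ [ x ∖ t ] ⟩)
exp-simulates {x} {t} {t′} V W pr α uq dis = simulates
  (weak⇒⟶ (weak-plug V (weak □ (exp W ncx nct x∉t))))
  -- The rule copies `t` and the machine `t′`; their translations agree, so no structural step is
  -- needed.
  (≡-subst (_⇛ᵈ db [] (V ⟨ W ⟨ t′ ⟩ [ x ∖ t ] ⟩))
    (sym (db-plug V (λ Γ → cong (_⟦ _ ⟧) (db-plug W (λ Γ → sym (α⇒db α Γ)) (x ∷ Γ))) [])) (_ , ε , ε))
  (Unique-resp-↭ (setoid _) (↭⇒↭ₛ (↭-sym perm)) (Unique.++⁺ uq (Proper.bv-unique pr) dis) , Proper.closed pr ∘ sub)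
  where
  hyg : Hygienic (W ⟨ var x ⟩ [ x ∖ t ])
  hyg = Hygienic-plug V (Proper⇒Hygienic pr)
  outside : Disjoint (x ∷ bv (W ⟨ var x ⟩)) (fv t)
  outside = proj₂ (proj₂ (Hygienic-es hyg))
  x∉t : x ∉ fv t
  x∉t q = outside (here refl , q)
  nct : NoCapture W t
  nct (p , q) = outside (there (captured⊆bv W p) , q)
  ncx : NoCapture W (var x)
  ncx (p , here refl) with x∉ ∷ _ ← Hygienic.bv-unique hyg = All.lookup x∉ (∈-++⁺ˡ (captured⊆bv W p)) refl
  perm : bv (V ⟨ W ⟨ t′ ⟩ [ x ∖ t ] ⟩) ↭ bv t′ ++ bv (V ⟨ W ⟨ var x ⟩ [ x ∖ t ] ⟩)
  perm = ≡-subst₂ (λ r s → bv r ↭ bv t′ ++ bv s) (plug-∘ V (W [ x ∖ t ]ˡ)) (plug-∘ V (W [ x ∖ t ]ˡ))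
                  (bv-plug-var (V ⟪ W [ x ∖ t ]ˡ ⟫))
  inner : ∀ {w} → w ∈ fv (W ⟨ t′ ⟩ [ x ∖ t ]) → w ∈ fv (W ⟨ var x ⟩ [ x ∖ t ])
  inner p with ∈-es⁻ (W ⟨ t′ ⟩) t p
  ... | inj₂ q = ∈-es⁺ʳ (W ⟨ var x ⟩) t q
  ... | inj₁ (q , w≢x) with fv-plug t′ (var x) inj₂ W q
  ...   | inj₁ r = ∈-es⁺ˡ (W ⟨ var x ⟩) t r w≢x
  ...   | inj₂ r = ∈-es⁺ʳ (W ⟨ var x ⟩) t (fv-α α r)
  sub : ∀ {w} → w ∈ fv (V ⟨ W ⟨ t′ ⟩ [ x ∖ t ] ⟩) → w ∈ fv (V ⟨ W ⟨ var x ⟩ [ x ∖ t ] ⟩)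
  sub = fv-plug-⊆ (W ⟨ t′ ⟩ [ x ∖ t ]) (W ⟨ var x ⟩ [ x ∖ t ]) inner V

look-simulates : ∀ C π E₁ E₂ → let E = E₁ ++ (x , t) ∷ E₂ in
                 Proper (readback ⟨ C , var x , π , E ⟩ˢ) → t′ =α t → Unique (bv t′) →
                 Disjoint (bv t′) (namesᶜ C ++ namesˢ π ++ namesᵉ E) →
                 Simulates (readback ⟨ C , var x , π , E ⟩ˢ) (readback ⟨ C , t′ , π , E ⟩ˢ)
look-simulates {x} {t} {t′} C π E₁ E₂ pr α uq dis =
  ≡-subst₂ Simulates (sym eq) (sym (readback-look C π E₁ E₂ t′))
    (exp-simulates (readᵉ E₂) (readᵉ E₁ ⟪ readᶜ C ⟪ readˢ π ⟫ ⟫) (≡-subst Proper eq pr) α uq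
      λ (p , q) → dis (p , bv-readback-var C π (E₁ ++ (x , t) ∷ E₂) (≡-subst (λ r → _ ∈ bv r) (sym eq) q)))
  where
  eq = readback-look {x} {t} C π E₁ E₂ (var x)

-- Simulation of whole runs

push-readback : ∀ C π E → readback ⟨ C , t · u , π , E ⟩ˢ ≡ readback ⟨ C , t , u ∷ π , E ⟩ˢ
push-readback C π E = cong (λ r → readᵉ E ⟨ readᶜ C ⟨ r ⟩ ⟩) (sym (plug-∘ (readˢ π) _))

pop-readback : ∀ C v E → readback ⟨ C , ⌜ v ⌝ , [] , (x , t) ∷ E ⟩ˢ ≡ readback ⟨ C ∷⟨ v , x ⟩ , t , [] , E ⟩ˢ
pop-readback C v E = plug-∘ (readᵉ E) _

-- The calculus works on a term `d` that differs from the read-back by the extrusions made so far: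
-- each simulating step is pulled back to `d`, and the new extrusions are composed with the old.
run⇒⟶* : Proper (readback Q) → d ⇛ᵈ db [] (readback Q) → Q ⟶* Q′ →
         ∃[ d′ ] ([] ⊢ d ⟶* d′ × d′ ⇛ᵈ db [] (readback Q′))

Simulates⇒⟶* : Simulates (readback Q) (readback Q′) → ∀ {Q″} → d ⇛ᵈ db [] (readback Q) → Q′ ⟶* Q″ →
               ∃[ d′ ] ([] ⊢ d ⟶* d′ × d′ ⇛ᵈ db [] (readback Q″))
Simulates⇒⟶* {Q} {Q′} (simulates red str pr) st ps
  with _ , q , st′ ← ⇛ᵈ-⟶ st red
  with _ , qs , st″ ← run⇒⟶* {Q = Q′} pr (⇛ᵈ-trans st′ str) ps
  = _ , q ◅ qs , st″

run⇒⟶* pr st ε = _ , ε , st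
run⇒⟶* pr st (push {C} {t} {u} {π} {E} ◅ ps) rewrite push-readback {t} {u} C π E = run⇒⟶* pr st ps
run⇒⟶* pr st (pop {C} {v} {x} {t} {E} ◅ ps) rewrite pop-readback {x} {t} C v E = run⇒⟶* pr st ps
run⇒⟶* pr st (beta {C} {x} {t} {u} {π} {E} ◅ ps) = Simulates⇒⟶* {⟨ C , ƛ x t , u ∷ π , E ⟩ˢ} (beta-simulates C π E pr) st ps
run⇒⟶* pr st (look {x} {t} {t′} {C} {π} E₁ E₂ α uq dis ◅ ps) =
  Simulates⇒⟶* {⟨ C , var x , π , E₁ ++ (x , t) ∷ E₂ ⟩ˢ} (look-simulates C π E₁ E₂ pr α uq dis) st ps

-- Termination of the machine

-- The counterpart on translations, by which `ESFree` is seen to be invariant under α.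
data ESFreeᵈ : Tm → Set where
  ix  : ∀ {i} → ESFreeᵈ (ix i)
  lam : ESFreeᵈ d → ESFreeᵈ (lam d)
  app : ESFreeᵈ d → ESFreeᵈ d′ → ESFreeᵈ (d ∙ d′)

ESFree⇒ᵈ : ESFree t → ESFreeᵈ (db Γ t)
ESFree⇒ᵈ var     = ix
ESFree⇒ᵈ (ƛ p)   = lam (ESFree⇒ᵈ p)
ESFree⇒ᵈ (p · q) = app (ESFree⇒ᵈ p) (ESFree⇒ᵈ q)

ᵈ⇒ESFree : ∀ t → ESFreeᵈ (db Γ t) → ESFree t
ᵈ⇒ESFree (var x) ix        = var
ᵈ⇒ESFree (ƛ x t) (lam p)   = ƛ (ᵈ⇒ESFree t p)
ᵈ⇒ESFree (t · u) (app p q) = ᵈ⇒ESFree t p · ᵈ⇒ESFree u q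

ESFree-α : t′ =α t → ESFree t → ESFree t′
ESFree-α {t′} α p = ᵈ⇒ESFree t′ (≡-subst ESFreeᵈ (sym (α⇒db α [])) (ESFree⇒ᵈ p))

fv-readˢ : ∀ π → w ∈ fv t → w ∈ fv (readˢ π ⟨ t ⟩)
fv-readˢ [] p = p
fv-readˢ {t = t} (s ∷ π) p rewrite plug-∘ {t} (readˢ π) (□ ·ˡ s) = fv-readˢ π (∈-·⁺ˡ t s p)

fv-readᶜ : ∀ C → w ∈ fv t → w ∈ fv (readᶜ C ⟨ t ⟩)
fv-readᶜ ε p = p
fv-readᶜ {t = t} (C ∷⟨ v , x ⟩) p = ∈-es⁺ʳ (readᶜ C ⟨ ⌜ v ⌝ ⟩) t p

-- Stacks and partial answers bind nothing at their holes, so in a closed read-back a variable in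
-- code position has an entry and its lookup is never stuck.
fv-readᵉ : ∀ E → w ∈ fv t → w ∈ fv (readᵉ E ⟨ t ⟩) ⊎ ∃[ E₁ ] ∃[ u ] ∃[ E₂ ] E ≡ E₁ ++ (w , u) ∷ E₂
fv-readᵉ [] p = inj₁ p
fv-readᵉ {w} {t} ((x , s) ∷ E) p rewrite plug-∘ {t} (readᵉ E) (□ [ x ∖ s ]ˡ) with w ≟ x
... | yes refl = inj₂ ([] , s , E , refl)
... | no  w≢x with fv-readᵉ E (∈-es⁺ˡ t s p w≢x)
...   | inj₁ q                   = inj₁ q
...   | inj₂ (E₁ , u , E₂ , refl) = inj₂ ((x , s) ∷ E₁ , u , E₂ , refl)

-- Lexicographic recursion in the order of the arguments: β and lookups descend in the evaluation of
-- `d`, pop shortens the environment, and push passes to a subterm of the code.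
terminates : Evaluates a d → ∀ E t C π → let Q = ⟨ C , t , π , E ⟩ˢ in
             Proper (readback Q) → d ⇛ᵈ db [] (readback Q) →
             ESFree t → All ESFree π → All (ESFree ∘ proj₂) E →
             ∃[ Q′ ] (Q ⟶* Q′ × a ⇛ᵈ db [] (readback Q′))
terminates ev E (t · u) C π pr st (p · q) fπ fE
  rewrite push-readback {t} {u} C π E
  with Q′ , ps , st′ ← terminates ev E t C (u ∷ π) pr st p (q ∷ fπ) fE
  = Q′ , push ◅ ps , st′
terminates ev [] (ƛ x t) C [] pr st f fπ fE =
  -- The final read-back is an answer, hence so is `d`, which is therefore normal and equal to `a`.
  _ , ε , ≡-subst (_⇛ᵈ _) (Evaluates-normal ev (Ans-normal (⇛ᵈ-Ans⁻¹ st (Answer⇒Ans (readᶜ-Answer C))))) st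
terminates ev ((y , s) ∷ E) (ƛ x t) C [] pr st f fπ (p ∷ fE)
  rewrite pop-readback {y} {s} C (ƛᵛ x t) E
  with Q′ , ps , st′ ← terminates ev E s (C ∷⟨ ƛᵛ x t , y ⟩) [] pr st p [] fE
  = Q′ , pop ◅ ps , st′
terminates (eval h _) E (ƛ x t) C (u ∷ π) pr st (ƛ p) (q ∷ fπ) fE
  with simulates red str pr′ ← beta-simulates C π E pr
  with _ , red′ , st′ ← ⇛ᵈ-⟶ st red
  with Q′ , ps , st″ ← terminates (h red′) ((x , u) ∷ E) t C π pr′ (⇛ᵈ-trans st′ str) p fπ (q ∷ fE)
  = Q′ , beta ◅ ps , st″
terminates (eval h _) E (var x) C π pr st f fπ fE
  with fv-readᵉ E (fv-readᶜ C (fv-readˢ π (here refl)))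
... | inj₁ x∈ = ⊥-elim (Proper.closed pr x∈)
... | inj₂ (E₁ , u , E₂ , refl)
  with u′ , eq , hyg , dis ← representative (db [] u) (namesᶜ C ++ namesˢ π ++ namesᵉ E)
  with simulates red str pr′ ← look-simulates C π E₁ E₂ pr (≡db⇒α eq) (Hygienic.bv-unique hyg) dis
  with _ , red′ , st′ ← ⇛ᵈ-⟶ st red
  with fu ∷ _ ← All.++⁻ʳ E₁ fE
  with Q′ , ps , st″ ← terminates (h red′) E u′ C π pr′ (⇛ᵈ-trans st′ str) (ESFree-α (≡db⇒α eq) fu) fπ fE
  = Q′ , look E₁ E₂ (≡db⇒α eq) (Hygienic.bv-unique hyg) dis ◅ ps , st″

-- Initial states and the two directions

Proper-initial : Closed t → t′ =α t → Unique (bv t′) → Proper t′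
Proper-initial closed α uq = uq , λ p → ∉[] (≡-subst (_ ∈_) closed (fv-α α p))
  where
  ∉[] : w ∉ []
  ∉[] ()

theorem10p9 : ∀ (t : Term) → Closed t →
    (∀ (Q Q′ : State) → InitialFor t Q → Q ⟶* Q′ →
    ∃[ s ] (t →w¬gcv* s × s ⇛ readback Q′))
    ×
    (ESFree t → ∀ (a : Term) → Answer a → t →w¬gcv* a →
    ∃[ Q ] ∃[ Q′ ] (InitialFor t Q × Q ⟶* Q′ × a ⇛ readback Q′))
theorem10p9 t closed = sound , complete
  where
  sound : ∀ Q Q′ → InitialFor t Q → Q ⟶* Q′ → ∃[ s ] (t →w¬gcv* s × s ⇛ readback Q′)
  sound _ Q′ (initial {t′} α uq) ps
    with d , ds , st ← run⇒⟶* (Proper-initial closed α uq) (_ , ε , ε) ps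
    with s , refl , _ ← representative d []
    = s , ⟶*-reflect (≡-subst ([] ⊢_⟶* _) (α⇒db α []) ds) , ⇛ᵈ-reflect st
  complete : ESFree t → ∀ a → Answer a → t →w¬gcv* a →
             ∃[ Q ] ∃[ Q′ ] (InitialFor t Q × Q ⟶* Q′ × a ⇛ readback Q′)
  complete f a ans-a ds
    with t′ , eq , hyg , _ ← representative (db [] t) []
    -- An answer is normal and so evaluates to itself; the given reduction carries this back to `t`.
    with Q′ , ps , st ← terminates
      (Evaluates-⟶*⁻¹ (→w¬gcv*⇒⟶* ds) (Normal⇒Evaluates (Ans-normal (Answer⇒Ans ans-a))))
      [] t′ ε [] (Proper-initial closed (≡db⇒α eq) (Hygienic.bv-unique hyg)) (≡-subst (_⇛ᵈ _) eq (_ , ε , ε))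
      (ESFree-α (≡db⇒α eq) f) [] []
    = _ , Q′ , initial (≡db⇒α eq) (Hygienic.bv-unique hyg) , ps , ⇛ᵈ-reflect st
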